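{- Let $Q$ be a spider web quiver with three circles and middle circle vertices $1,\dots,n$, carrying $y$-variables $y_v$, and set $y_0:=1$. For each outer vertex $i^-$ connected to the middle circle let $d_i$ (resp. $e_i$) be the minimal (resp. maximal) $j$ such that $i^-$ is connected to $j$; for each inner vertex $i^+$ connected to the middle circle let $f_i$ (resp. $g_i$) be the minimal (resp. maximal) such $j$. Applying $\tau=\mu_1\cdots\mu_{n-2}s_{n-1,n}\mu_n\cdots\mu_1$ yields the following $y$-variables $y'$: (1) If $1\le i\le n-1$, $$y_i'=\frac{\sum_{j=i}^{n}\prod_{k=i}^{j-1}y_k+\left(\prod_{k=i}^n y_k\right)\left(\sum_{j=0}^{i-2}\prod_{k=0}^j y_k\right)}{\sum_{j=i+1}^{n-1}\prod_{k=i+1}^{j}y_k+\left(\prod_{k=i+1}^n y_k\right)\left(\sum_{j=0}^{i}\prod_{k=0}^j y_k\right)}.$$ (2) $$y_n'=\frac{1+y_n\sum_{j=0}^{n-2}\prod_{k=0}^j y_k}{\sum_{j=1}^{n-1}\prod_{k=1}^j y_k+\prod_{k=1}^n y_k}.$$ (3) If there are no edges between $i^-$ and the middle circle, $y_{i^- }'=y_{i^- }$. (4) If $i$ is maximal such that there are edges between $i^-$ and the middle circle, $$y_{i^- }'=y_{i^- }\frac{\left(\prod_{k=e_i+1}^n y_k\right)\left(\sum_{j=d_1}^{n-1}\prod_{k=0}^j y_k+\left(\prod_{k=0}^n y_k\right)\left(\sum_{j=0}^{d_1-1}\prod_{k=0}^j y_k\right)\right)}{\sum_{j=e_i+1}^n\prod_{k=e_i+1}^{j-1}y_k+\left(\prod_{k=e_i+1}^n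 y_k\right)\left(\sum_{j=0}^{e_i-1}\prod_{k=0}^j y_k\right)}.$$ (5) Otherwise, $$y_{i^- }'=y_{i^- }\frac{\sum_{j=e_i}^{n-1}\prod_{k=d_i+1}^j y_k+\left(\prod_{k=d_i+1}^n y_k\right)\left(\sum_{j=0}^{e_i-1}\prod_{k=0}^j y_k\right)}{\sum_{j=d_i+1}^n\prod_{k=d_i+1}^{j-1}y_k+\left(\prod_{k=d_i+1}^n y_k\right)\left(\sum_{j=0}^{d_i-1}\prod_{k=0}^j y_k\right)}.$$ (6) If there are no edges between $i^+$ and the middle circle, $y_{i^+}'=y_{i^+}$. (7) If $i$ is maximal such that there are edges between $i^+$ and the middle circle, $$y_{i^+}'=y_{i^+}\frac{\left(\prod_{k=g_i+1}^n y_k\right)\left(\sum_{j=f_1}^{n-1}\prod_{k=0}^j y_k+\left(\prod_{k=0}^n y_k\right)\left(\sum_{j=0}^{f_1-1}\prod_{k=0}^j y_k\right)\right)}{\sum_{j=g_i+1}^n\prod_{k=g_i+1}^{j-1}y_k+\left(\prod_{k=g_i+1}^n y_k\right)\left(\sum_{j=0}^{g_i-1}\prod_{k=0}^j y_k\right)}.$$ (8) Otherwise, $$y_{i^+}'=y_{i^+}\frac{\sum_{j=g_i}^{n-1}\prod_{k=f_i+1}^j y_k+\left(\prod_{k=f_i+1}^n y_k\right)\left(\sum_{j=0}^{g_i-1}\prod_{k=0}^j y_k\right)}{\sum_{j=f_i+1}^n\prod_{k=f_i+1}^{j-1}y_k+\left(\prod_{k=f_i+1}^n y_k\right)\left(\sum_{j=0}^{f_i-1}\prod_{k=0}^j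 y_k\right)}.$$
   Context: Quiver: directed graph with no loops or 2-cycles. Mutation $\mu_k$ of a $y$-seed $(Q,\mathbf y)$: the quiver is mutated at $k$ (add $i\to j$ for each $i\to k\to j$, reverse arrows at $k$, remove 2-cycles) and $y_k'=y_k^{ -1}$; for $i\ne k$, $y_i'=y_i(1+y_k^{ -1})^{ -m}$ if there are $m$ arrows $k\to i$, and $y_i'=y_i(1+y_k)^{m}$ if there are $m$ arrows $i\to k$. $s_{n-1,n}$ transposes vertices $n-1$ and $n$; $\tau$ is applied rightmost first. Spider web quiver: three concentric circles, at least 2 vertices on each, circle edges oriented counterclockwise, arrows between adjacent circles such that each face is a directed cycle with exactly two arrows between circles and at least 3 sides. Middle circle vertices labeled $1,\dots,n$ following the arrows. If $i$ is the lowest-index middle vertex with an edge to the outer circle, the outer vertex with an arrow to $i$ is $1^-$, and the outer circle continues $2^-,3^-,\dots$ following the arrows; the inner circle is labeled $1^+,2^+,\dots$ in the same way using the lowest-index middle vertex with an edge to the inner circle. Empty sums are 0 and empty products are 1. -}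

module Defs where

open import Level using (Level; _⊔_) renaming (suc to lsuc)
open import Data.Bool using (Bool; true; false; if_then_else_)
open import Data.Maybe using (Maybe; just; nothing)
open import Data.Empty using (⊥)
open import Data.Unit using (⊤)
open import Data.Nat as ℕ using (ℕ; zero; suc; _≤_; _<_; _∸_; NonZero)
import Data.Nat.Properties as ℕP
open import Data.Nat.DivMod using (_%_; m%n<n)
open import Data.Fin as Fin using (Fin; toℕ; fromℕ<)
open import Data.Product using (_×_; _,_; Σ; proj₂)
open import Data.List as List using (List; []; _∷_)
open import Data.Unit.Polymorphic using () renaming (⊤ to ⊤ₚ)
open import Data.Empty.Polymorphic using () renaming (⊥ to ⊥ₚ)
open import Relation.Nullary using (¬_; Dec; yes; no; does)
open import Relation.Binary.PropositionalEquality using (_≡_; refl; cong)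
open import Relation.Binary.Core using (Rel)
open import Algebra.Core using (Op₁; Op₂)
open import Algebra.Structures using (IsCommutativeSemigroup; IsAbelianGroup)
open import Algebra.Definitions using (_DistributesOver_)

-- Semifields (the y-variables live in the universal semifield
-- generated by the initial y_v; an identity of subtraction-free
-- rational expressions holds there iff it holds in every semifield).

record Semifield (c ℓ : Level) : Set (lsuc (c ⊔ ℓ)) where
  infixl 7 _*_
  infixl 6 _+_
  infix  4 _≈_
  field
    Carrier : Set c
    _≈_     : Rel Carrier ℓ
    _+_     : Op₂ Carrier
    _*_     : Op₂ Carrier
    1#      : Carrier
    _⁻¹     : Op₁ Carrier
    +-isCommutativeSemigroup : IsCommutativeSemigroup _≈_ _+_
    *-isAbelianGroup         : IsAbelianGroup _≈_ _*_ 1# _⁻¹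
    distrib                  : _DistributesOver_ _≈_ _*_ _+_

-- Vertices of a spider web quiver: outer circle (Fin a, index t is the
-- vertex (t+1)^-), middle circle (Fin n, index t is vertex t+1),
-- inner circle (Fin b, index t is vertex (t+1)^+).

data Vtx (a n b : ℕ) : Set where
  out : Fin a → Vtx a n b
  mid : Fin n → Vtx a n b
  inn : Fin b → Vtx a n b

_≟V_ : ∀ {a n b} (u v : Vtx a n b) → Dec (u ≡ v)
out i ≟V out j with i Fin.≟ j
... | yes refl = yes refl
... | no ne = no λ { refl → ne refl }
out i ≟V mid j = no λ ()
out i ≟V inn j = no λ ()
mid i ≟V out j = no λ ()
mid i ≟V mid j with i Fin.≟ j
... | yes refl = yes refl
... | no ne = no λ { refl → ne refl }
mid i ≟V inn j = no λ ()
inn i ≟V out j = no λ ()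
inn i ≟V mid j = no λ ()
inn i ≟V inn j with i Fin.≟ j
... | yes refl = yes refl
... | no ne = no λ { refl → ne refl }

-- Quivers on a vertex type V: Q u v = number of arrows u → v.

Quiver : Set → Set
Quiver V = V → V → ℕ

cyc : ∀ {m} → Fin m → Fin m
cyc {suc m} i = fromℕ< (m%n<n (suc (toℕ i)) (suc m))

count : ∀ {r} → (Fin r → Bool) → ℕ
count {zero}  f = 0
count {suc r} f = (if f Fin.zero then 1 else 0) ℕ.+ count (λ t → f (Fin.suc t))

StrictlyIncreasing : ∀ {r m} → (Fin r → Fin m) → Set
StrictlyIncreasing f = ∀ s t → s Fin.< t → f s Fin.< f t

-- Combinatorial data of the arrows between the middle circle and the
-- outer (resp. inner) circle.  For t : Fin r the arrows are
--   p t → x t   and   x (t+1 mod r) → p t,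
-- with p, x strictly increasing and p 0 = 0 (i.e. p 0 is the vertex 1^-,
-- x 0 being the lowest middle vertex with an edge to that circle).
-- Every spider web quiver with its labelling arises in this way, and conversely.
record Annulus (c n : ℕ) : Set where
  field
    r     : ℕ
    2≤r   : 2 ≤ r
    p     : Fin r → Fin c
    x     : Fin r → Fin n
    p-inc : StrictlyIncreasing p
    x-inc : StrictlyIncreasing x
    p-fst : ∀ t → toℕ t ≡ 0 → toℕ (p t) ≡ 0

record SpiderData : Set where
  field
    a n b : ℕ
    2≤a   : 2 ≤ a
    2≤n   : 2 ≤ n
    2≤b   : 2 ≤ b
    outer : Annulus a n
    inner : Annulus b n

module _ (D : SpiderData) where
  open SpiderData D

  V : Set
  V = Vtx a n b

  private
    _==_ : ∀ {m} → Fin m → Fin m → Bool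
    i == j = does (i Fin.≟ j)

    -- circle arrow i → i+1 (mod m); on a circle with exactly two
    -- vertices the two circle edges form a 2-cycle, which is removed.
    circ : (m : ℕ) → Fin m → Fin m → ℕ
    circ m i j with does (3 ℕ.≤? m)
    ... | false = 0
    ... | true  = if does (toℕ j ℕ.≟ toℕ (cyc i)) then 1 else 0

    toMid : ∀ {c} → Annulus c n → Fin c → Fin n → ℕ
    toMid A i j = count (λ t → (p t == i) Data.Bool.∧ (x t == j))
      where open Annulus A

    fromMid : ∀ {c} → Annulus c n → Fin n → Fin c → ℕ
    fromMid A j i = count (λ t → (p t == i) Data.Bool.∧ (x (cyc t) == j))
      where open Annulus A

  spiderQuiver : Quiver V
  spiderQuiver (out i) (out j) = circ a i j
  spiderQuiver (mid i) (mid j) = circ n i j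
  spiderQuiver (inn i) (inn j) = circ b i j
  spiderQuiver (out i) (mid j) = toMid outer i j
  spiderQuiver (mid j) (out i) = fromMid outer j i
  spiderQuiver (inn i) (mid j) = toMid inner i j
  spiderQuiver (mid j) (inn i) = fromMid inner j i
  spiderQuiver (out _) (inn _) = 0
  spiderQuiver (inn _) (out _) = 0

module _ {c ℓ} (F : Semifield c ℓ) where
  open Semifield F

  _^_ : Carrier → ℕ → Carrier
  z ^ zero  = 1#
  z ^ suc m = z * (z ^ m)

  YSeed : Set → Set c
  YSeed V = Quiver V × (V → Carrier)

  mutate : ∀ {V : Set} → (∀ (u v : V) → Dec (u ≡ v)) → V → YSeed V → YSeed V
  mutate {V} _≟_ k (Q , y) = Q′ , y′
    where
    Q′ : Quiver V
    Q′ i j with does (i ≟ k) | does (j ≟ k)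
    ... | true  | _     = Q j i
    ... | false | true  = Q j i
    ... | false | false =
      (Q i j ℕ.+ Q i k ℕ.* Q k j) ∸ (Q j i ℕ.+ Q j k ℕ.* Q k i)
    y′ : V → Carrier
    y′ i with does (i ≟ k)
    ... | true  = y k ⁻¹
    ... | false = y i * (((1# + y k ⁻¹) ⁻¹) ^ Q k i) * ((1# + y k) ^ Q i k)

  relabel : ∀ {V : Set} → (V → V) → YSeed V → YSeed V
  relabel σ (Q , y) = (λ u v → Q (σ u) (σ v)) , (λ u → y (σ u))

module _ (D : SpiderData) where
  open SpiderData D

  swapLast : V D → V D
  swapLast (mid i) with toℕ i ℕ.≟ (n ∸ 2) | toℕ i ℕ.≟ (n ∸ 1)
  ... | yes _ | _     = mid (cyc i)
  ... | no _  | yes _ = mid (Fin.pred i)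
  ... | no _  | no _  = mid i
  swapLast v = v

module _ {c ℓ} (F : Semifield c ℓ) (D : SpiderData) where
  open Semifield F
  open SpiderData D

  mutateList : List (V D) → YSeed F (V D) → YSeed F (V D)
  mutateList []       s = s
  mutateList (k ∷ ks) s = mutateList ks (mutate F _≟V_ k s)

  -- τ = μ_1 ⋯ μ_{n-2} s_{n-1,n} μ_n ⋯ μ_1 (rightmost first)
  tau : YSeed F (V D) → YSeed F (V D)
  tau s =
    mutateList (List.map mid (List.reverse (List.filter (λ k → toℕ k ℕ.<? (n ∸ 2)) (List.allFin n))))
      (relabel F (swapLast D)
        (mutateList (List.map mid (List.allFin n)) s))

  tauY : (V D → Carrier) → V D → Carrier
  tauY y = proj₂ (tau (spiderQuiver D , y))

-- Subtraction-free rational expressions with 0 adjoined (for empty sums):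
-- nothing plays the role of 0.

module Expr {c ℓ} (F : Semifield c ℓ) where
  open Semifield F

  S₀ : Set c
  S₀ = Maybe Carrier

  0₀ 1₀ : S₀
  0₀ = nothing
  1₀ = just 1#

  infixl 7 _*₀_ _÷₀_
  infixl 6 _+₀_
  infix  4 _≈₀_

  _+₀_ : S₀ → S₀ → S₀
  nothing +₀ v       = v
  just u  +₀ nothing = just u
  just u  +₀ just v  = just (u + v)

  _*₀_ : S₀ → S₀ → S₀
  just u *₀ just v = just (u * v)
  _      *₀ _      = nothing

  -- division; a zero denominator gives the junk value 0
  _÷₀_ : S₀ → S₀ → S₀
  just u ÷₀ just v = just (u * v ⁻¹)
  _      ÷₀ _      = nothing

  _≈₀_ : S₀ → S₀ → Set ℓ
  just u  ≈₀ just v  = u ≈ v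
  nothing ≈₀ nothing = ⊤ₚ
  _       ≈₀ _       = ⊥ₚ

  Σ[_,_⟩ : ℕ → ℕ → (ℕ → S₀) → S₀
  Σ[ lo , hi ⟩ f = go lo (hi ∸ lo)
    where
    go : ℕ → ℕ → S₀
    go l zero    = 0₀
    go l (suc k) = f l +₀ go (suc l) k

  Π[_,_⟩ : ℕ → ℕ → (ℕ → S₀) → S₀
  Π[ lo , hi ⟩ Y = go lo (hi ∸ lo)
    where
    go : ℕ → ℕ → S₀
    go l zero    = 1₀
    go l (suc k) = Y l *₀ go (suc l) k

module Formulas {c ℓ} (F : Semifield c ℓ) (D : SpiderData) (y : V D → Semifield.Carrier F) where
  open Semifield F
  open SpiderData D
  open Expr F public

  -- y_k indexed by the middle-circle label k ∈ {1,…,n}, with y_0 = 1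
  -- (values outside 0..n never occur in the formulas)
  Y : ℕ → S₀
  Y zero = 1₀
  Y (suc k) with k ℕ.<? n
  ... | yes k<n = just (y (mid (fromℕ< k<n)))
  ... | no _    = 0₀

  P : ℕ → ℕ → S₀
  P lo hi = Π[ lo , hi ⟩ Y

  lab : Fin n → ℕ
  lab j = suc (toℕ j)

  y′ : V D → Carrier
  y′ = tauY F D y

  Q : Quiver (V D)
  Q = spiderQuiver D

  Conn : V D → Fin n → Set
  Conn v j = 0 < Q v (mid j) ℕ.+ Q (mid j) v

  IsMinConn : V D → Fin n → Set
  IsMinConn v d = Conn v d × (∀ j → Conn v j → d Fin.≤ j)

  IsMaxConn : V D → Fin n → Set
  IsMaxConn v e = Conn v e × (∀ j → Conn v j → j Fin.≤ e)

  num1 den1 : ℕ → S₀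
  num1 i = Σ[ i , suc n ⟩ (λ j → P i j) +₀ P i (suc n) *₀ Σ[ 0 , i ∸ 1 ⟩ (λ j → P 0 (suc j))
  den1 i = Σ[ suc i , n ⟩ (λ j → P (suc i) (suc j))
           +₀ P (suc i) (suc n) *₀ Σ[ 0 , suc i ⟩ (λ j → P 0 (suc j))

  num2 den2 : S₀
  num2 = 1₀ +₀ Y n *₀ Σ[ 0 , n ∸ 1 ⟩ (λ j → P 0 (suc j))
  den2 = Σ[ 1 , n ⟩ (λ j → P 1 (suc j)) +₀ P 1 (suc n)

  numMax denMax : ℕ → ℕ → S₀
  numMax e d₁ = P (suc e) (suc n) *₀
    (Σ[ d₁ , n ⟩ (λ j → P 0 (suc j)) +₀ P 0 (suc n) *₀ Σ[ 0 , d₁ ⟩ (λ j → P 0 (suc j)))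
  denMax e d₁ = Σ[ suc e , suc n ⟩ (λ j → P (suc e) j)
                +₀ P (suc e) (suc n) *₀ Σ[ 0 , e ⟩ (λ j → P 0 (suc j))

  numOth denOth : ℕ → ℕ → S₀
  numOth d e = Σ[ e , n ⟩ (λ j → P (suc d) (suc j))
               +₀ P (suc d) (suc n) *₀ Σ[ 0 , e ⟩ (λ j → P 0 (suc j))
  denOth d e = Σ[ suc d , suc n ⟩ (λ j → P (suc d) j)
               +₀ P (suc d) (suc n) *₀ Σ[ 0 , d ⟩ (λ j → P 0 (suc j))

  CircleClaims : (m : ℕ) → (Fin m → V D) → Set ℓ
  CircleClaims m emb =
    (∀ (i : Fin m) → (∀ j → ¬ Conn (emb i) j) → y′ (emb i) ≈ y (emb i))
    ×
    (∀ (i : Fin m) (d e : Fin n) → IsMinConn (emb i) d → IsMaxConn (emb i) e →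
       (∀ (i′ : Fin m) → i Fin.< i′ → ∀ j → ¬ Conn (emb i′) j) →
       ∀ (first : Fin m) (d₁ : Fin n) → toℕ first ≡ 0 → IsMinConn (emb first) d₁ →
       just (y′ (emb i)) ≈₀ just (y (emb i)) *₀ (numMax (lab e) (lab d₁) ÷₀ denMax (lab e) (lab d₁)))
    ×
    (∀ (i : Fin m) (d e : Fin n) → IsMinConn (emb i) d → IsMaxConn (emb i) e →
       Σ (Fin m) (λ i′ → i Fin.< i′ × Σ (Fin n) (λ j → Conn (emb i′) j)) →
       just (y′ (emb i)) ≈₀ just (y (emb i)) *₀ (numOth (lab d) (lab e) ÷₀ denOth (lab d) (lab e)))

  Theorem6p8Claims : Set ℓ
  Theorem6p8Claims =
    (∀ (i : Fin n) → lab i ≤ n ∸ 1 →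
       just (y′ (mid i)) ≈₀ num1 (lab i) ÷₀ den1 (lab i))
    ×
    (∀ (i : Fin n) → lab i ≡ n → just (y′ (mid i)) ≈₀ num2 ÷₀ den2)
    ×
    CircleClaims a out
    ×
    CircleClaims b inn

{-# OPTIONS --safe #-}

-- Number the middle vertices 0, …, M and let p j be the product of the first j
-- of their y-variables, continued by p (j + n) = p n * p j where n = M + 1.
-- Every sum in the theorem is, up to a monomial, a sum W i of n consecutive
-- values of p starting with p i.
--
-- τ is nested: with T s the composite acting on the vertices s, …, M, one has
-- T s = μ s ∘ T (s + 1) ∘ μ s, starting from T (M - 1) = σ ∘ μ M ∘ μ (M - 1) with σ
-- the transposition.  After μ s the vertices s + 1, …, M again form an
-- oriented cycle and every other vertex, including s itself, is attached to it by
-- a "chord": one arrow to a vertex α of the cycle and one arrow from a vertex β.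
-- By induction T s preserves the quiver and multiplies the variable of such a
-- vertex by W (β + 1) / W (α + 1), times p n if β < α.  The induction works because
-- μ s divides all W i with i > s + 1 by the same factor 1 + y s, and because
-- (1 + y s) W (s + 1) = y s W s + W (s + 2).
module Submission where

open import Defs
open import Level as Level using (Level; _⊔_)
open import Algebra.Bundles using (CommutativeSemiring)
open import Algebra.Structures using (IsCommutativeSemigroup; IsAbelianGroup)
open import Algebra.Structures.Biased using (isCommutativeSemiringˡ)
import Algebra.Properties.AbelianGroup as AbelianGroupProperties
open import Data.Bool using (Bool; true; false; if_then_else_; _∧_)
open import Data.Empty using (⊥-elim)
open import Data.Fin as Fin using (Fin; toℕ)
import Data.Fin.Properties as Fin
open import Data.List as List using (List; []; _∷_; _++_)
import Data.List.Properties as List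
import Data.List.Relation.Unary.All.Properties as All
open import Data.Maybe using (just; nothing)
open import Data.Nat as ℕ using (ℕ; zero; suc; _≤_; _<_; _∸_; s≤s; z≤n)
import Data.Nat.Properties as ℕ
open import Data.Nat.DivMod using (_%_; _mod_; m%n<n; m<n⇒m%n≡m; n%n≡0)
open import Data.Product using (Σ; _×_; _,_; ∃; ∃₂; proj₁; proj₂)
open import Data.Sum using (_⊎_; inj₁; inj₂)
open import Data.Unit.Polymorphic using (tt)
open import Function using (_∘_; id; _∋_)
open import Relation.Nullary using (Dec; yes; no; does; ¬_)
open import Relation.Nullary.Decidable using (dec-true; dec-false; toSum)
open import Relation.Binary.Definitions using (tri<; tri≈; tri>)
open import Relation.Binary.PropositionalEquality as ≡ using (_≡_; _≢_; cong; cong₂)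
open import Relation.Binary.Structures using (IsEquivalence)

-- Window sums

-- The vertices of the cycle obey the same rule as the attached ones: each gains the chord factor of
-- its two neighbours on the cycle, divided by p n. A chord may have α = β. This covers vertices not
-- joined to the cycle as well as the cycle of two vertices, whose arrows cancel, so neither needs
-- separate treatment in the invariant. Empty sums force a zero into the expressions. All
-- computations therefore take place in a commutative semiring without subtraction or division:
-- identities are stated with denominators cleared, and common factors are cancelled because they
-- are nonzero. A cycle vertex is joined to any other vertex by at most one arrow, so a mutation
-- there changes a variable in only three ways besides inverting its own.

module WindowSums {r ℓ} (R : CommutativeSemiring r ℓ) where
  open CommutativeSemiring R
  open import Relation.Binary.Reasoning.Setoid setoid
  open import Algebra.Solver.Ring.NaturalCoefficients.Default R

  sumFrom prodFrom : (ℕ → Carrier) → ℕ → ℕ → Carrier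
  sumFrom f l zero    = 0#
  sumFrom f l (suc k) = f l + sumFrom f (suc l) k
  prodFrom f l zero    = 1#
  prodFrom f l (suc k) = f l * prodFrom f (suc l) k

  ∑ ∏ : (ℕ → Carrier) → ℕ → ℕ → Carrier
  ∑ f lo hi = sumFrom f lo (hi ∸ lo)
  ∏ f lo hi = prodFrom f lo (hi ∸ lo)

  suc-∸-suc : ∀ {lo hi} → lo < hi → hi ∸ lo ≡ suc (hi ∸ suc lo)
  suc-∸-suc {lo} {suc hi} (s≤s lo≤hi) = ℕ.+-∸-assoc 1 lo≤hi

  ∑-empty : ∀ f lo → ∑ f lo lo ≡ 0#
  ∑-empty f lo = ≡.cong (sumFrom f lo) (ℕ.n∸n≡0 lo)

  ∏-empty : ∀ f lo → ∏ f lo lo ≡ 1#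
  ∏-empty f lo = ≡.cong (prodFrom f lo) (ℕ.n∸n≡0 lo)

  ∑-head : ∀ f {lo hi} → lo < hi → ∑ f lo hi ≡ f lo + ∑ f (suc lo) hi
  ∑-head f {lo} lo<hi = ≡.cong (sumFrom f lo) (suc-∸-suc lo<hi)

  ∏-head : ∀ f {lo hi} → lo < hi → ∏ f lo hi ≡ f lo * ∏ f (suc lo) hi
  ∏-head f {lo} lo<hi = ≡.cong (prodFrom f lo) (suc-∸-suc lo<hi)

  sumFrom-cong : ∀ {f g} l k → (∀ j → l ≤ j → j < l ℕ.+ k → f j ≈ g j) →
                 sumFrom f l k ≈ sumFrom g l k
  sumFrom-cong l zero    f≈g = refl
  sumFrom-cong l (suc k) f≈g = +-cong
    (f≈g l ℕ.≤-refl (ℕ.m<m+n l (s≤s z≤n)))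
    (sumFrom-cong (suc l) k λ j l<j j<l+k →
      f≈g j (ℕ.<⇒≤ l<j) (≡.subst (j <_) (≡.sym (ℕ.+-suc l k)) j<l+k))

  prodFrom-cong : ∀ {f g} l k → (∀ j → l ≤ j → j < l ℕ.+ k → f j ≈ g j) →
                  prodFrom f l k ≈ prodFrom g l k
  prodFrom-cong l zero    f≈g = refl
  prodFrom-cong l (suc k) f≈g = *-cong
    (f≈g l ℕ.≤-refl (ℕ.m<m+n l (s≤s z≤n)))
    (prodFrom-cong (suc l) k λ j l<j j<l+k →
      f≈g j (ℕ.<⇒≤ l<j) (≡.subst (j <_) (≡.sym (ℕ.+-suc l k)) j<l+k))

  private
    in-range : ∀ {lo hi j} → lo ≤ j → j < lo ℕ.+ (hi ∸ lo) → j < hi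
    in-range {lo} {hi} {j} lo≤j j< with ℕ.≤-total lo hi
    ... | inj₁ lo≤hi = ≡.subst (j <_) (ℕ.m+[n∸m]≡n lo≤hi) j<
    ... | inj₂ hi≤lo rewrite ℕ.m≤n⇒m∸n≡0 hi≤lo | ℕ.+-identityʳ lo =
      ⊥-elim (ℕ.<⇒≱ j< lo≤j)

  ∑-cong : ∀ {f g lo hi} → (∀ j → lo ≤ j → j < hi → f j ≈ g j) → ∑ f lo hi ≈ ∑ g lo hi
  ∑-cong {lo = lo} {hi} f≈g =
    sumFrom-cong lo (hi ∸ lo) λ j lo≤j j< → f≈g j lo≤j (in-range lo≤j j<)

  ∏-cong : ∀ {f g lo hi} → (∀ j → lo ≤ j → j < hi → f j ≈ g j) → ∏ f lo hi ≈ ∏ g lo hi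
  ∏-cong {lo = lo} {hi} f≈g =
    prodFrom-cong lo (hi ∸ lo) λ j lo≤j j< → f≈g j lo≤j (in-range lo≤j j<)

  *-distrib-sumFrom : ∀ a f l k → a * sumFrom f l k ≈ sumFrom (λ j → a * f j) l k
  *-distrib-sumFrom a f l zero    = zeroʳ a
  *-distrib-sumFrom a f l (suc k) =
    trans (distribˡ a (f l) _) (+-congˡ (*-distrib-sumFrom a f (suc l) k))

  *-distrib-∑ : ∀ a f lo hi → a * ∑ f lo hi ≈ ∑ (λ j → a * f j) lo hi
  *-distrib-∑ a f lo hi = *-distrib-sumFrom a f lo (hi ∸ lo)

  prodFrom-++ : ∀ f l k m → prodFrom f l (k ℕ.+ m) ≈ prodFrom f l k * prodFrom f (l ℕ.+ k) m
  prodFrom-++ f l zero m rewrite ℕ.+-identityʳ l = sym (*-identityˡ _)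
  prodFrom-++ f l (suc k) m rewrite ℕ.+-suc l k =
    trans (*-congˡ (prodFrom-++ f (suc l) k m)) (sym (*-assoc _ _ _))

  ∏-split : ∀ f {lo mi hi} → lo ≤ mi → mi ≤ hi → ∏ f lo hi ≈ ∏ f lo mi * ∏ f mi hi
  ∏-split f {lo} {mi} {hi} lo≤mi mi≤hi = begin
    prodFrom f lo (hi ∸ lo)
      ≡⟨ ≡.cong (prodFrom f lo) hi∸lo≡ ⟩
    prodFrom f lo ((mi ∸ lo) ℕ.+ (hi ∸ mi))
      ≈⟨ prodFrom-++ f lo (mi ∸ lo) (hi ∸ mi) ⟩
    ∏ f lo mi * prodFrom f (lo ℕ.+ (mi ∸ lo)) (hi ∸ mi)
      ≡⟨ ≡.cong (λ m → ∏ f lo mi * prodFrom f m (hi ∸ mi)) (ℕ.m+[n∸m]≡n lo≤mi) ⟩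
    ∏ f lo mi * ∏ f mi hi ∎
    where
    hi∸lo≡ : hi ∸ lo ≡ (mi ∸ lo) ℕ.+ (hi ∸ mi)
    hi∸lo≡ = ≡.trans (≡.cong (_∸ lo) (≡.sym (ℕ.m∸n+n≡m mi≤hi)))
      (≡.trans (ℕ.+-∸-assoc (hi ∸ mi) lo≤mi) (ℕ.+-comm (hi ∸ mi) _))

  ∏-singleton : ∀ f lo → ∏ f lo (suc lo) ≈ f lo
  ∏-singleton f lo = trans
    (reflexive (≡.trans (∏-head f ℕ.≤-refl) (≡.cong (f lo *_) (∏-empty f (suc lo)))))
    (*-identityʳ (f lo))

  ∏-last : ∀ f {lo hi} → lo ≤ hi → ∏ f lo (suc hi) ≈ ∏ f lo hi * f hi
  ∏-last f {lo} {hi} lo≤hi =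
    trans (∏-split f lo≤hi (ℕ.n≤1+n hi)) (*-congˡ (∏-singleton f hi))

  -- With p j = z s ⋯ z (j ∸ 1), continued by p (j + n ∸ s) = p n * p j, this is
  -- the sum of p over a window of length n ∸ s starting at i, where n = suc M.
  W : ℕ → ℕ → (ℕ → Carrier) → ℕ → Carrier
  W s M z i = ∑ (∏ z s) i (suc M) + ∏ z s (suc M) * ∑ (∏ z s) s i

  -- One period later every term of the window has gained the factor p n: at `suc M` the first sum
  -- is empty and the second already runs over a full period.
  W-last : ∀ s M z → W s M z (suc M) ≈ ∏ z s (suc M) * W s M z s
  W-last s M z rewrite ∑-empty (∏ z s) (suc M) | ∑-empty (∏ z s) s =
    solve 2 (λ a b → con 0 :+ a :* b := a :* (b :+ a :* con 0)) refl
      (∏ z s (suc M)) (∑ (∏ z s) s (suc M))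

  -- The three windows involved have a common part and differ by p s = 1,
  -- p (suc s) = z s, p n and p n * z s.
  W-three-term : ∀ {s M} z → s < M →
    (1# + z s) * W s M z (suc s) ≈ z s * W s M z s + W s M z (suc (suc s))
  W-three-term {s} {M} z s<M
    rewrite ∑-head (∏ z s) {s} {suc M} (ℕ.m≤n⇒m≤1+n s<M)
          | ∑-head (∏ z s) {suc s} {suc M} (s≤s s<M)
          | ∑-head (∏ z s) {s} {suc (suc s)} (s≤s (ℕ.n≤1+n s))
          | ∑-head (∏ z s) {s} {suc s} ℕ.≤-refl
          | ∑-head (∏ z s) {suc s} {suc (suc s)} ℕ.≤-refl
          | ∑-empty (∏ z s) s
          | ∑-empty (∏ z s) (suc s)
          | ∑-empty (∏ z s) (suc (suc s))
          | ∏-empty z s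
          | ∏-head z {s} {suc s} ℕ.≤-refl
          | ∏-empty z (suc s) =
    solve 3 (λ q b Y → (con 1 :+ q) :* ((q :* con 1 :+ b) :+ Y :* (con 1 :+ con 0))
                     := q :* ((con 1 :+ (q :* con 1 :+ b)) :+ Y :* con 0)
                        :+ (b :+ Y :* (con 1 :+ (q :* con 1 :+ con 0)))) refl
      (z s) (∑ (∏ z s) (suc (suc s)) (suc M)) (∏ z s (suc M))

  module Shrink {s M} (z ẑ : ℕ → Carrier) (1+s<M : suc s < M)
    (ẑ-first : (1# + z s) * ẑ (suc s) ≈ z s * z (suc s))
    (ẑ-last  : ẑ M ≈ z M * (1# + z s))
    (ẑ-mid   : ∀ {j} → suc s < j → j < M → ẑ j ≈ z j)
    where

    private
      q = 1# + z s

    -- `ẑ` is what a mutation at `s` makes of the variables on the shorter cycle. Before `M` only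
    -- its first factor deviates: it absorbs `z s` and a division by `q`, which then persists in all
    -- later partial products.
    ∏-shrink : ∀ {j} → suc (suc s) ≤ j → j ≤ M → q * ∏ ẑ (suc s) j ≈ ∏ z s j
    ∏-shrink {suc j} 2+s≤1+j 1+j≤M with ℕ.m≤n⇒m<n∨m≡n 2+s≤1+j
    ... | inj₂ ≡.refl = begin
      q * ∏ ẑ (suc s) (suc (suc s))  ≈⟨ *-congˡ (∏-singleton ẑ (suc s)) ⟩
      q * ẑ (suc s)                  ≈⟨ ẑ-first ⟩
      z s * z (suc s)                ≈⟨ *-congʳ (sym (∏-singleton z s)) ⟩
      ∏ z s (suc s) * z (suc s)      ≈⟨ sym (∏-last z (ℕ.n≤1+n s)) ⟩
      ∏ z s (suc (suc s))            ∎
    ... | inj₁ (s≤s 2+s≤j) = begin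
      q * ∏ ẑ (suc s) (suc j)    ≈⟨ *-congˡ (∏-last ẑ (ℕ.<⇒≤ 2+s≤j)) ⟩
      q * (∏ ẑ (suc s) j * ẑ j)  ≈⟨ sym (*-assoc _ _ _) ⟩
      q * ∏ ẑ (suc s) j * ẑ j    ≈⟨ *-cong (∏-shrink 2+s≤j (ℕ.<⇒≤ 1+j≤M)) (ẑ-mid 2+s≤j 1+j≤M) ⟩
      ∏ z s j * z j              ≈⟨ sym (∏-last z (ℕ.<⇒≤ (ℕ.<⇒≤ 2+s≤j))) ⟩
      ∏ z s (suc j)              ∎

    -- The division by `q` at the first vertex and the multiplication by `q` at the last compensate,
    -- so the period factor stays the same.
    ∏-total : ∏ ẑ (suc s) (suc M) ≈ ∏ z s (suc M)
    ∏-total = begin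
      ∏ ẑ (suc s) (suc M)          ≈⟨ ∏-last ẑ (ℕ.<⇒≤ 1+s<M) ⟩
      ∏ ẑ (suc s) M * ẑ M          ≈⟨ *-congˡ ẑ-last ⟩
      ∏ ẑ (suc s) M * (z M * q)    ≈⟨ solve 3 (λ a b c → a :* (b :* c) := c :* a :* b) refl _ _ _ ⟩
      q * ∏ ẑ (suc s) M * z M      ≈⟨ *-congʳ (∏-shrink 1+s<M ℕ.≤-refl) ⟩
      ∏ z s M * z M                ≈⟨ sym (∏-last z (ℕ.<⇒≤ (ℕ.<⇒≤ 1+s<M))) ⟩
      ∏ z s (suc M)                ∎

    ∑-shrink : ∀ {lo hi} → suc (suc s) ≤ lo → hi ≤ suc M →
               q * ∑ (∏ ẑ (suc s)) lo hi ≈ ∑ (∏ z s) lo hi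
    ∑-shrink {lo} {hi} 2+s≤lo hi≤1+M = trans (*-distrib-∑ q (∏ ẑ (suc s)) lo hi)
      (∑-cong {lo = lo} {hi} λ j lo≤j j<hi →
        ∏-shrink (ℕ.≤-trans 2+s≤lo lo≤j) (ℕ.≤-pred (ℕ.≤-trans j<hi hi≤1+M)))

    -- The shorter window has one term fewer. Its initial term 1, multiplied by `q`, is `1# + z s`
    -- and supplies the two terms p s and p (s + 1) at once.
    ∑-shrink-first : ∀ {hi} → suc (suc s) ≤ hi → hi ≤ suc M →
                     q * ∑ (∏ ẑ (suc s)) (suc s) hi ≈ ∑ (∏ z s) s hi
    ∑-shrink-first {hi} 2+s≤hi hi≤1+M = begin
      q * ∑ p̂ (suc s) hi
        ≡⟨ ≡.cong (q *_) (∑-head p̂ 2+s≤hi) ⟩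
      q * (p̂ (suc s) + ∑ p̂ (suc (suc s)) hi)
        ≡⟨ ≡.cong (λ a → q * (a + ∑ p̂ (suc (suc s)) hi)) (∏-empty ẑ (suc s)) ⟩
      q * (1# + ∑ p̂ (suc (suc s)) hi)
        ≈⟨ distribˡ _ _ _ ⟩
      q * 1# + q * ∑ p̂ (suc (suc s)) hi
        ≈⟨ +-cong (*-identityʳ q) (∑-shrink ℕ.≤-refl hi≤1+M) ⟩
      1# + z s + ∑ p (suc (suc s)) hi
        ≈⟨ +-assoc _ _ _ ⟩
      1# + (z s + ∑ p (suc (suc s)) hi)
        ≈⟨ +-cong (reflexive (≡.sym (∏-empty z s))) (+-congʳ (sym (∏-singleton z s))) ⟩
      p s + (p (suc s) + ∑ p (suc (suc s)) hi)
        ≡⟨ ≡.cong (p s +_) (∑-head p 2+s≤hi) ⟨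
      p s + ∑ p (suc s) hi
        ≡⟨ ∑-head p (ℕ.<⇒≤ 2+s≤hi) ⟨
      ∑ p s hi ∎
      where
      p = ∏ z s
      p̂ = ∏ ẑ (suc s)

    W-shrink : ∀ {i} → suc (suc s) ≤ i → i ≤ suc M → q * W (suc s) M ẑ i ≈ W s M z i
    W-shrink {i} 2+s≤i i≤1+M = begin
      q * (∑ p̂ i (suc M) + Ŷ * ∑ p̂ (suc s) i)
        ≈⟨ solve 4 (λ a b c d → a :* (b :+ c :* d) := a :* b :+ c :* (a :* d)) refl _ _ _ _ ⟩
      q * ∑ p̂ i (suc M) + Ŷ * (q * ∑ p̂ (suc s) i)
        ≈⟨ +-cong (∑-shrink 2+s≤i ℕ.≤-refl) (*-cong ∏-total (∑-shrink-first 2+s≤i i≤1+M)) ⟩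
      W s M z i ∎
      where
      p̂ = ∏ ẑ (suc s)
      Ŷ = ∏ ẑ (suc s) (suc M)

    -- The first window of the shorter cycle matches the window at `s`, not at `suc s`. This shift
    -- is what sets the vertex `suc s` apart in the induction step.
    W-shrink-first : q * W (suc s) M ẑ (suc s) ≈ W s M z s
    W-shrink-first
      rewrite ∑-empty (∏ ẑ (suc s)) (suc s) | ∑-empty (∏ z s) s = begin
      q * (∑ (∏ ẑ (suc s)) (suc s) (suc M) + ∏ ẑ (suc s) (suc M) * 0#)
        ≈⟨ *-congˡ (trans (+-congˡ (zeroʳ _)) (+-identityʳ _)) ⟩
      q * ∑ (∏ ẑ (suc s)) (suc s) (suc M)
        ≈⟨ ∑-shrink-first (ℕ.m≤n⇒m≤1+n 1+s<M) ℕ.≤-refl ⟩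
      ∑ (∏ z s) s (suc M)
        ≈⟨ sym (trans (+-congˡ (zeroʳ _)) (+-identityʳ _)) ⟩
      ∑ (∏ z s) s (suc M) + ∏ z s (suc M) * 0# ∎

-- Quiver mutation along the circle

δ : ℕ → ℕ → ℕ
δ i j = if does (i ℕ.≟ j) then 1 else 0

δ-refl : ∀ i → δ i i ≡ 1
δ-refl i rewrite dec-true (i ℕ.≟ i) ≡.refl = ≡.refl

δ-≢ : ∀ {i j} → i ≢ j → δ i j ≡ 0
δ-≢ {i} {j} i≢j rewrite dec-false (i ℕ.≟ j) i≢j = ≡.refl

δ-∸-δ : ∀ j {a b} → a ≢ b → δ j a ∸ δ j b ≡ δ j a
δ-∸-δ j {a} {b} a≢b with toSum (j ℕ.≟ a)
... | inj₁ ≡.refl rewrite δ-≢ a≢b = ≡.refl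
... | inj₂ j≢a  rewrite δ-≢ j≢a = ℕ.0∸n≡0 (δ j b)

-- One of `x ∸ y` and `y ∸ x` vanishes and the other is the net difference, which is all that the
-- outer subtraction sees.
∸-+-∸ : ∀ x y p q → ((x ∸ y) ℕ.+ q) ∸ ((y ∸ x) ℕ.+ p) ≡ (x ℕ.+ q) ∸ (y ℕ.+ p)
∸-+-∸ zero    y       p q rewrite ℕ.0∸n≡0 y = ≡.refl
∸-+-∸ (suc x) zero    p q = ≡.refl
∸-+-∸ (suc x) (suc y) p q = ∸-+-∸ x y p q

∸-∸-∸ : ∀ x y → (x ∸ y) ∸ (y ∸ x) ≡ x ∸ y
∸-∸-∸ zero    y       rewrite ℕ.0∸n≡0 y = ℕ.0∸n≡0 y
∸-∸-∸ (suc x) zero    = ≡.refl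
∸-∸-∸ (suc x) (suc y) = ∸-∸-∸ x y

+-interchange-∸ : ∀ x y p q → ((x ℕ.+ p) ℕ.+ q) ∸ ((y ℕ.+ q) ℕ.+ p) ≡ x ∸ y
+-interchange-∸ x y p q
  rewrite ℕ.+-assoc x p q | ℕ.+-assoc y q p | ℕ.+-comm q p
        | ℕ.+-comm x (p ℕ.+ q) | ℕ.+-comm y (p ℕ.+ q) = ℕ.[m+n]∸[m+o]≡n∸o (p ℕ.+ q) x y

module QuiverMutation {V : Set} (_≟_ : ∀ (u v : V) → Dec (u ≡ v)) where

  infix 4 _≐_
  _≐_ : Quiver V → Quiver V → Set
  Q ≐ Q′ = ∀ u v → Q u v ≡ Q′ u v

  -- No loops or 2-cycles.
  Reduced : Quiver V → Set
  Reduced Q = ∀ u v → Q u v ∸ Q v u ≡ Q u v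

  μ : V → Quiver V → Quiver V
  μ k Q i j with does (i ≟ k) | does (j ≟ k)
  ... | true  | _     = Q j i
  ... | false | true  = Q j i
  ... | false | false =
    (Q i j ℕ.+ Q i k ℕ.* Q k j) ∸ (Q j i ℕ.+ Q j k ℕ.* Q k i)

  μ-from : ∀ k Q v → μ k Q k v ≡ Q v k
  μ-from k Q v rewrite dec-true (k ≟ k) ≡.refl = ≡.refl

  μ-to : ∀ k Q v → μ k Q v k ≡ Q k v
  μ-to k Q v with does (v ≟ k)
  ... | true = ≡.refl
  ... | false rewrite dec-true (k ≟ k) ≡.refl = ≡.refl

  μ-else : ∀ {k} Q {u v} → u ≢ k → v ≢ k →
    μ k Q u v ≡ (Q u v ℕ.+ Q u k ℕ.* Q k v) ∸ (Q v u ℕ.+ Q v k ℕ.* Q k u)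
  μ-else {k} Q {u} {v} u≢k v≢k
    rewrite dec-false (u ≟ k) u≢k | dec-false (v ≟ k) v≢k = ≡.refl

  μ-cong : ∀ k {Q Q′} → Q ≐ Q′ → μ k Q ≐ μ k Q′
  μ-cong k Q≐ i j with does (i ≟ k) | does (j ≟ k)
  ... | true  | _     = Q≐ j i
  ... | false | true  = Q≐ j i
  ... | false | false
    rewrite Q≐ i j | Q≐ i k | Q≐ k j | Q≐ j i | Q≐ j k | Q≐ k i = ≡.refl

  Reduced-cong : ∀ {Q Q′} → Q ≐ Q′ → Reduced Q → Reduced Q′
  Reduced-cong Q≐ red u v rewrite ≡.sym (Q≐ u v) | ≡.sym (Q≐ v u) = red u v

  μ-reduced : ∀ k Q → Reduced Q → Reduced (μ k Q)
  μ-reduced k Q red u v with toSum (u ≟ k) | toSum (v ≟ k)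
  ... | inj₁ ≡.refl | _ rewrite μ-from k Q v | μ-to k Q v = red v k
  ... | inj₂ _ | inj₁ ≡.refl rewrite μ-from k Q u | μ-to k Q u = red k u
  ... | inj₂ u≢k | inj₂ v≢k rewrite μ-else Q u≢k v≢k | μ-else Q v≢k u≢k =
    ∸-∸-∸ (Q u v ℕ.+ Q u k ℕ.* Q k v) (Q v u ℕ.+ Q v k ℕ.* Q k u)

  -- A second mutation contributes the same two products as the first, exchanged.
  μ-cancel : ∀ {Q u v} → Reduced Q → ∀ p q →
    (((Q u v ℕ.+ p) ∸ (Q v u ℕ.+ q)) ℕ.+ q) ∸ (((Q v u ℕ.+ q) ∸ (Q u v ℕ.+ p)) ℕ.+ p) ≡ Q u v
  μ-cancel {Q} {u} {v} red p q =
    ≡.trans (∸-+-∸ (Q u v ℕ.+ p) (Q v u ℕ.+ q) p q)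
      (≡.trans (+-interchange-∸ (Q u v) (Q v u) p q) (red u v))

  μ-involutive : ∀ k Q → Reduced Q → μ k (μ k Q) ≐ Q
  μ-involutive k Q red u v with toSum (u ≟ k) | toSum (v ≟ k)
  ... | inj₁ ≡.refl | _ rewrite μ-from k (μ k Q) v = μ-to k Q v
  ... | inj₂ _ | inj₁ ≡.refl rewrite μ-to k (μ k Q) u = μ-from k Q u
  ... | inj₂ u≢k | inj₂ v≢k
    rewrite μ-else (μ k Q) u≢k v≢k | μ-else Q u≢k v≢k | μ-else Q v≢k u≢k
          | μ-to k Q u | μ-to k Q v | μ-from k Q u | μ-from k Q v
          | ℕ.*-comm (Q k u) (Q v k) | ℕ.*-comm (Q k v) (Q u k)
    = μ-cancel {Q} red (Q u k ℕ.* Q k v) (Q v k ℕ.* Q k u)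

  -- Cycles, chords and their behaviour under mutation

  module Circle (c : ℕ → V) (M : ℕ)
    (c-injective : ∀ {i j} → i ≤ M → j ≤ M → c i ≡ c j → i ≡ j) where

    -- Among the vertices c s , … , c M, the vertex v has exactly an arrow to c α
    -- and an arrow from c β; these cancel when α ≡ β.
    record Chord (s : ℕ) (Q : Quiver V) (v : V) (α β : ℕ) : Set where
      constructor chord
      field
        s≤α : s ≤ α
        α≤M : α ≤ M
        s≤β : s ≤ β
        β≤M : β ≤ M
        to   : ∀ {j} → s ≤ j → j ≤ M → Q v (c j) ≡ δ j α ∸ δ j β
        from : ∀ {j} → s ≤ j → j ≤ M → Q (c j) v ≡ δ j β ∸ δ j α
    open Chord

    Outside : ℕ → V → Set
    Outside s v = ∀ {j} → s ≤ j → j ≤ M → v ≢ c j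

    -- c s → c (suc s) → ⋯ → c M → c s is an oriented cycle (empty if M ≡ suc s).
    record CircleQuiver (s : ℕ) (Q : Quiver V) : Set where
      field
        reduced  : Reduced Q
        first    : Chord s Q (c s) (suc s) M
        middle   : ∀ {i} → s ≤ i → suc i < M → Chord s Q (c (suc i)) (suc (suc i)) i
        last     : Chord s Q (c M) s (ℕ.pred M)
        outside  : ∀ {v} → Outside s v → ∃₂ (Chord s Q v)
    open CircleQuiver

    module _ {s Q v α β} (C : Chord s Q v α β) where
      private
        s≤M = ℕ.≤-trans (s≤α C) (α≤M C)

      -- This and the next three lemmas split according to which ends of the chord lie at `c s`. In
      -- each case at most one arrow joins `v` and `c s`.
      chord-neutral : s ≢ α → s ≢ β → Q v (c s) ≡ 0 × Q (c s) v ≡ 0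
      chord-neutral s≢α s≢β rewrite to C ℕ.≤-refl s≤M | from C ℕ.≤-refl s≤M
        | δ-≢ s≢α | δ-≢ s≢β = ≡.refl , ≡.refl

      chord-to : s ≡ α → s ≢ β → Q v (c s) ≡ 1 × Q (c s) v ≡ 0
      chord-to ≡.refl s≢β rewrite to C ℕ.≤-refl s≤M | from C ℕ.≤-refl s≤M
        | δ-refl s | δ-≢ s≢β = ≡.refl , ≡.refl

      chord-from : s ≢ α → s ≡ β → Q v (c s) ≡ 0 × Q (c s) v ≡ 1
      chord-from s≢α ≡.refl rewrite to C ℕ.≤-refl s≤M | from C ℕ.≤-refl s≤M
        | δ-refl s | δ-≢ s≢α = ≡.refl , ≡.refl

      chord-both : s ≡ α → s ≡ β → Q v (c s) ≡ 0 × Q (c s) v ≡ 0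
      chord-both ≡.refl ≡.refl rewrite to C ℕ.≤-refl s≤M | from C ℕ.≤-refl s≤M
        | δ-refl s = ≡.refl , ≡.refl

    c-≢ : ∀ {i j} → i < j → j ≤ M → c j ≢ c i
    c-≢ i<j j≤M eq =
      ℕ.<⇒≢ i<j (≡.sym (c-injective j≤M (ℕ.≤-trans (ℕ.<⇒≤ i<j) j≤M) eq))

    chord-cong : ∀ {s Q Q′ v α β} → Q ≐ Q′ → Chord s Q v α β → Chord s Q′ v α β
    chord-cong Q≐ (chord a b a′ b′ t f) = chord a b a′ b′
      (λ s≤j j≤M → ≡.trans (≡.sym (Q≐ _ _)) (t s≤j j≤M))
      (λ s≤j j≤M → ≡.trans (≡.sym (Q≐ _ _)) (f s≤j j≤M))

    module MutateFirst {s} (1+s<M : suc s < M) {Q} (circle : CircleQuiver s Q) where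

      private
        k = c s

        s<M : s < M
        s<M = ℕ.<⇒≤ 1+s<M

        1+s≢M : suc s ≢ M
        1+s≢M = ℕ.<⇒≢ 1+s<M

        k-to : ∀ {j} → suc s ≤ j → j ≤ M → Q k (c j) ≡ δ j (suc s)
        k-to {j} s<j j≤M = ≡.trans (to (first circle) (ℕ.<⇒≤ s<j) j≤M) (δ-∸-δ j 1+s≢M)

        k-from : ∀ {j} → suc s ≤ j → j ≤ M → Q (c j) k ≡ δ j M
        k-from {j} s<j j≤M = ≡.trans (from (first circle) (ℕ.<⇒≤ s<j) j≤M) (δ-∸-δ j (1+s≢M ∘ ≡.sym))

        -- `X` and `Y` count the arrows from and to `v` after the paths through `k` are added but
        -- before 2-cycles are removed; only their truncated differences must agree with the new
        -- chord.
        chord-by : ∀ {v α β} (X Y : ℕ → ℕ) →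
          suc s ≤ α → α ≤ M → suc s ≤ β → β ≤ M → v ≢ k →
          (∀ {j} → suc s ≤ j → j ≤ M → Q v (c j) ℕ.+ Q v k ℕ.* Q k (c j) ≡ X j) →
          (∀ {j} → suc s ≤ j → j ≤ M → Q (c j) v ℕ.+ Q (c j) k ℕ.* Q k v ≡ Y j) →
          (∀ j → X j ∸ Y j ≡ δ j α ∸ δ j β) →
          (∀ j → Y j ∸ X j ≡ δ j β ∸ δ j α) →
          Chord (suc s) (μ k Q) v α β
        chord-by X Y s<α α≤M s<β β≤M v≢k X-def Y-def X∸Y Y∸X = chord s<α α≤M s<β β≤M
          (λ {j} s<j j≤M → ≡.trans (μ-else Q v≢k (c-≢ s<j j≤M))
            (≡.trans (cong₂ _∸_ (X-def s<j j≤M) (Y-def s<j j≤M)) (X∸Y j)))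
          (λ {j} s<j j≤M → ≡.trans (μ-else Q (c-≢ s<j j≤M) v≢k)
            (≡.trans (cong₂ _∸_ (Y-def s<j j≤M) (X-def s<j j≤M)) (Y∸X j)))

      module _ {v α β} (v≢k : v ≢ k) (C : Chord s Q v α β) where

        μ-chord-neutral : s ≢ α → s ≢ β → Chord (suc s) (μ k Q) v α β
        μ-chord-neutral s≢α s≢β = chord-by (λ j → δ j α ∸ δ j β) (λ j → δ j β ∸ δ j α)
          (ℕ.≤∧≢⇒< (s≤α C) s≢α) (α≤M C) (ℕ.≤∧≢⇒< (s≤β C) s≢β) (β≤M C) v≢k X-def Y-def
          (λ j → ∸-∸-∸ (δ j α) (δ j β)) (λ j → ∸-∸-∸ (δ j β) (δ j α))
          where
          X-def : ∀ {j} → suc s ≤ j → j ≤ M → Q v (c j) ℕ.+ Q v k ℕ.* Q k (c j) ≡ δ j α ∸ δ j β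
          X-def s<j j≤M rewrite proj₁ (chord-neutral C s≢α s≢β) =
            ≡.trans (ℕ.+-identityʳ _) (to C (ℕ.<⇒≤ s<j) j≤M)
          Y-def : ∀ {j} → suc s ≤ j → j ≤ M → Q (c j) v ℕ.+ Q (c j) k ℕ.* Q k v ≡ δ j β ∸ δ j α
          Y-def {j} s<j j≤M rewrite proj₂ (chord-neutral C s≢α s≢β) | ℕ.*-zeroʳ (Q (c j) k) =
            ≡.trans (ℕ.+-identityʳ _) (from C (ℕ.<⇒≤ s<j) j≤M)

        -- The path v → c s → c (s + 1) carries the outgoing end one step along the cycle. It may
        -- meet `β` there, and then the two ends cancel.
        μ-chord-to : s ≡ α → s ≢ β → Chord (suc s) (μ k Q) v (suc s) β
        μ-chord-to ≡.refl s≢β = chord-by (λ j → δ j (suc s)) (λ j → δ j β)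
          ℕ.≤-refl s<M (ℕ.≤∧≢⇒< (s≤β C) s≢β) (β≤M C) v≢k X-def Y-def
          (λ _ → ≡.refl) (λ _ → ≡.refl)
          where
          X-def : ∀ {j} → suc s ≤ j → j ≤ M → Q v (c j) ℕ.+ Q v k ℕ.* Q k (c j) ≡ δ j (suc s)
          X-def {j} s<j j≤M rewrite proj₁ (chord-to C ≡.refl s≢β) | to C (ℕ.<⇒≤ s<j) j≤M
            | δ-≢ (ℕ.<⇒≢ s<j ∘ ≡.sym) | ℕ.0∸n≡0 (δ j β) | k-to s<j j≤M = ℕ.+-identityʳ _
          Y-def : ∀ {j} → suc s ≤ j → j ≤ M → Q (c j) v ℕ.+ Q (c j) k ℕ.* Q k v ≡ δ j β
          Y-def {j} s<j j≤M rewrite proj₂ (chord-to C ≡.refl s≢β) | ℕ.*-zeroʳ (Q (c j) k)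
            | from C (ℕ.<⇒≤ s<j) j≤M | δ-≢ (ℕ.<⇒≢ s<j ∘ ≡.sym) = ℕ.+-identityʳ _

        -- The path c M → c s → v carries the incoming end back to the predecessor of c s on the
        -- cycle.
        μ-chord-from : s ≢ α → s ≡ β → Chord (suc s) (μ k Q) v α M
        μ-chord-from s≢α ≡.refl = chord-by (λ j → δ j α) (λ j → δ j M)
          (ℕ.≤∧≢⇒< (s≤α C) s≢α) (α≤M C) s<M ℕ.≤-refl v≢k X-def Y-def
          (λ _ → ≡.refl) (λ _ → ≡.refl)
          where
          X-def : ∀ {j} → suc s ≤ j → j ≤ M → Q v (c j) ℕ.+ Q v k ℕ.* Q k (c j) ≡ δ j α
          X-def {j} s<j j≤M rewrite proj₁ (chord-from C s≢α ≡.refl) | to C (ℕ.<⇒≤ s<j) j≤M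
            | δ-≢ (ℕ.<⇒≢ s<j ∘ ≡.sym) = ℕ.+-identityʳ _
          Y-def : ∀ {j} → suc s ≤ j → j ≤ M → Q (c j) v ℕ.+ Q (c j) k ℕ.* Q k v ≡ δ j M
          Y-def {j} s<j j≤M rewrite proj₂ (chord-from C s≢α ≡.refl) | ℕ.*-identityʳ (Q (c j) k)
            | from C (ℕ.<⇒≤ s<j) j≤M | δ-≢ (ℕ.<⇒≢ s<j ∘ ≡.sym) | ℕ.0∸n≡0 (δ j α) = k-from s<j j≤M

        -- The vertex is not joined to the cycle. As `s` leaves the range, the coinciding ends need
        -- another common value; any one in the range represents the same chord.
        μ-chord-both : s ≡ α → s ≡ β → Chord (suc s) (μ k Q) v M M
        μ-chord-both ≡.refl ≡.refl = chord-by (λ _ → 0) (λ _ → 0)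
          s<M ℕ.≤-refl s<M ℕ.≤-refl v≢k X-def Y-def
          (λ j → ≡.sym (ℕ.n∸n≡0 (δ j M))) (λ j → ≡.sym (ℕ.n∸n≡0 (δ j M)))
          where
          X-def : ∀ {j} → suc s ≤ j → j ≤ M → Q v (c j) ℕ.+ Q v k ℕ.* Q k (c j) ≡ 0
          X-def {j} s<j j≤M rewrite proj₁ (chord-both C ≡.refl ≡.refl) | to C (ℕ.<⇒≤ s<j) j≤M
            | δ-≢ (ℕ.<⇒≢ s<j ∘ ≡.sym) = ≡.refl
          Y-def : ∀ {j} → suc s ≤ j → j ≤ M → Q (c j) v ℕ.+ Q (c j) k ℕ.* Q k v ≡ 0
          Y-def {j} s<j j≤M rewrite proj₂ (chord-both C ≡.refl ≡.refl) | ℕ.*-zeroʳ (Q (c j) k)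
            | from C (ℕ.<⇒≤ s<j) j≤M | δ-≢ (ℕ.<⇒≢ s<j ∘ ≡.sym) = ≡.refl

      μ-chord-k : Chord (suc s) (μ k Q) k M (suc s)
      μ-chord-k = chord s<M ℕ.≤-refl ℕ.≤-refl s<M
        (λ {j} s<j j≤M → ≡.trans (μ-from k Q (c j))
          (≡.trans (k-from s<j j≤M) (≡.sym (δ-∸-δ j (1+s≢M ∘ ≡.sym)))))
        (λ {j} s<j j≤M → ≡.trans (μ-to k Q (c j))
          (≡.trans (k-to s<j j≤M) (≡.sym (δ-∸-δ j 1+s≢M))))

      outside-extend : ∀ {v} → v ≢ k → Outside (suc s) v → Outside s v
      outside-extend v≢k v∉ s≤j j≤M with ℕ.m≤n⇒m<n∨m≡n s≤j
      ... | inj₁ s<j  = v∉ s<j j≤M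
      ... | inj₂ ≡.refl = v≢k

      s≢pred-M : s ≢ ℕ.pred M
      s≢pred-M = ℕ.<⇒≢ (ℕ.pred-mono-≤ 1+s<M)

      -- The path c M → c s → c (s + 1) closes the shorter cycle. If only two vertices remain, the
      -- new arrow cancels c (s + 1) → c M, which `first` expresses by equal ends.
      μ-circle : CircleQuiver (suc s) (μ k Q)
      μ-circle = record
        { reduced = μ-reduced k Q (reduced circle)
        ; first   = μ-chord-from (c-≢ ℕ.≤-refl s<M) (middle circle ℕ.≤-refl 1+s<M)
                      (ℕ.<⇒≢ (s≤s (ℕ.n≤1+n s))) ≡.refl
        ; middle  = λ s<i 1+i<M → μ-chord-neutral
                      (c-≢ (ℕ.m≤n⇒m≤1+n s<i) (ℕ.<⇒≤ 1+i<M))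
                      (middle circle (ℕ.<⇒≤ s<i) 1+i<M)
                      (ℕ.<⇒≢ (ℕ.m≤n⇒m≤1+n (ℕ.m≤n⇒m≤1+n s<i))) (ℕ.<⇒≢ s<i)
        ; last    = μ-chord-to (c-≢ s<M ℕ.≤-refl) (last circle) ≡.refl s≢pred-M
        ; outside = outside′
        }
        where
        outside′ : ∀ {v} → Outside (suc s) v → ∃₂ (Chord (suc s) (μ k Q) v)
        outside′ {v} v∉ with v ≟ k
        ... | yes ≡.refl = M , suc s , μ-chord-k
        ... | no v≢k with outside circle (outside-extend v≢k v∉)
        ...   | α , β , C with s ℕ.≟ α | s ℕ.≟ β
        ...     | yes s≡α | yes s≡β = M , M , μ-chord-both v≢k C s≡α s≡β
        ...     | yes s≡α | no  s≢β = suc s , β , μ-chord-to v≢k C s≡α s≢β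
        ...     | no  s≢α | yes s≡β = α , M , μ-chord-from v≢k C s≢α s≡β
        ...     | no  s≢α | no  s≢β = α , β , μ-chord-neutral v≢k C s≢α s≢β

    module LastTwo {s} (M≡1+s : M ≡ suc s) {Q} (circle : CircleQuiver s Q) where

      private
        a = c s
        b = c M

        s≤M : s ≤ M
        s≤M = ℕ.≤-trans (ℕ.n≤1+n s) (ℕ.≤-reflexive (≡.sym M≡1+s))

      a≢b : a ≢ b
      a≢b eq = c-≢ (ℕ.≤-reflexive (≡.sym M≡1+s)) ℕ.≤-refl (≡.sym eq)

      first-or-last : ∀ {i} → s ≤ i → i ≤ M → i ≡ s ⊎ i ≡ M
      first-or-last s≤i i≤M with ℕ.m≤n⇒m<n∨m≡n s≤i
      ... | inj₂ ≡.refl = inj₁ ≡.refl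
      ... | inj₁ s<i  = inj₂ (ℕ.≤-antisym i≤M (ℕ.≤-trans (ℕ.≤-reflexive M≡1+s) s<i))

      outside-two : ∀ {v} → v ≢ a → v ≢ b → Outside s v
      outside-two v≢a v≢b s≤j j≤M with first-or-last s≤j j≤M
      ... | inj₁ ≡.refl = v≢a
      ... | inj₂ ≡.refl = v≢b

      chord-at : ∀ u → ∃₂ (Chord s Q u)
      chord-at u with toSum (u ≟ a) | toSum (u ≟ b)
      ... | inj₁ ≡.refl | _         = _ , _ , first circle
      ... | inj₂ _    | inj₁ ≡.refl = _ , _ , last circle
      ... | inj₂ u≢a  | inj₂ u≢b  = outside circle (outside-two u≢a u≢b)

      -- With two vertices `δ s i` and `δ M i` add up to 1, so passing from one vertex to the other
      -- reverses every difference.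
      δ-complement : ∀ {i j} → s ≤ i → i ≤ M → s ≤ j → j ≤ M → δ M i ∸ δ M j ≡ δ s j ∸ δ s i
      δ-complement s≤i i≤M s≤j j≤M
        with first-or-last s≤i i≤M | first-or-last s≤j j≤M
      ... | inj₁ ≡.refl | inj₁ ≡.refl = ≡.trans (ℕ.n∸n≡0 (δ M s)) (≡.sym (ℕ.n∸n≡0 (δ s s)))
      ... | inj₂ ≡.refl | inj₂ ≡.refl = ≡.trans (ℕ.n∸n≡0 (δ M M)) (≡.sym (ℕ.n∸n≡0 (δ s M)))
      ... | inj₁ ≡.refl | inj₂ ≡.refl
        rewrite δ-refl s | δ-refl M | δ-≢ (a≢b ∘ cong c) | δ-≢ (a≢b ∘ ≡.sym ∘ cong c) = ≡.refl
      ... | inj₂ ≡.refl | inj₁ ≡.refl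
        rewrite δ-refl s | δ-refl M | δ-≢ (a≢b ∘ cong c) | δ-≢ (a≢b ∘ ≡.sym ∘ cong c) = ≡.refl

      -- The arrows at `b` are those at `a` reversed, which is what lets a transposition undo the
      -- two mutations.
      to-b : ∀ u → Q u b ≡ Q a u
      to-b u with chord-at u
      ... | α , β , C = ≡.trans (to C s≤M ℕ.≤-refl)
        (≡.trans (δ-complement (s≤α C) (α≤M C) (s≤β C) (β≤M C)) (≡.sym (from C ℕ.≤-refl s≤M)))

      from-b : ∀ u → Q b u ≡ Q u a
      from-b u with chord-at u
      ... | α , β , C = ≡.trans (from C s≤M ℕ.≤-refl)
        (≡.trans (δ-complement (s≤β C) (β≤M C) (s≤α C) (α≤M C)) (≡.sym (to C ℕ.≤-refl s≤M)))

      Qaa : Q a a ≡ 0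
      Qaa = ≡.trans (≡.sym (reduced circle a a)) (ℕ.n∸n≡0 (Q a a))

      Qbb : Q b b ≡ 0
      Qbb = ≡.trans (≡.sym (reduced circle b b)) (ℕ.n∸n≡0 (Q b b))

      Qab : Q a b ≡ 0
      Qab = ≡.trans (to-b a) Qaa

      Qba : Q b a ≡ 0
      Qba = ≡.trans (from-b a) Qaa

      μa-from-b : ∀ v → μ a Q b v ≡ Q b v
      μa-from-b v with toSum (v ≟ a)
      ... | inj₁ ≡.refl = ≡.trans (μ-to a Q b) (≡.trans Qab (≡.sym Qba))
      ... | inj₂ v≢a rewrite μ-else Q (a≢b ∘ ≡.sym) v≢a | Qab | Qba
        | ℕ.*-zeroʳ (Q v a) | ℕ.+-identityʳ (Q b v) | ℕ.+-identityʳ (Q v b) = reduced circle b v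

      μa-to-b : ∀ v → μ a Q v b ≡ Q v b
      μa-to-b v with toSum (v ≟ a)
      ... | inj₁ ≡.refl = ≡.trans (μ-from a Q b) (≡.trans Qba (≡.sym Qab))
      ... | inj₂ v≢a rewrite μ-else Q v≢a (a≢b ∘ ≡.sym) | Qab | Qba
        | ℕ.*-zeroʳ (Q v a) | ℕ.+-identityʳ (Q b v) | ℕ.+-identityʳ (Q v b) = reduced circle v b

      private
        Q₂ = μ b (μ a Q)

        Q₂-from-b : ∀ v → Q₂ b v ≡ Q v b
        Q₂-from-b v = ≡.trans (μ-from b (μ a Q) v) (μa-to-b v)

        Q₂-to-b : ∀ v → Q₂ v b ≡ Q b v
        Q₂-to-b v = ≡.trans (μ-to b (μ a Q) v) (μa-from-b v)

        Q₂-from-a : ∀ {v} → v ≢ b → Q₂ a v ≡ Q v a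
        Q₂-from-a {v} v≢b rewrite μ-else (μ a Q) a≢b v≢b | μa-to-b a | μa-from-b a | Qab | Qba
          | ℕ.*-zeroʳ (μ a Q v b) | μ-from a Q v | μ-to a Q v
          | ℕ.+-identityʳ (Q v a) | ℕ.+-identityʳ (Q a v) = reduced circle v a

        Q₂-to-a : ∀ {v} → v ≢ b → Q₂ v a ≡ Q a v
        Q₂-to-a {v} v≢b rewrite μ-else (μ a Q) v≢b a≢b | μa-to-b a | μa-from-b a | Qab | Qba
          | ℕ.*-zeroʳ (μ a Q v b) | μ-from a Q v | μ-to a Q v
          | ℕ.+-identityʳ (Q v a) | ℕ.+-identityʳ (Q a v) = reduced circle a v

      module _ (σ : V → V) (σ-a : σ a ≡ b) (σ-b : σ b ≡ a)
               (σ-fix : ∀ {v} → v ≢ a → v ≢ b → σ v ≡ v) where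

        -- As `a` and `b` are not joined, the mutations reverse all arrows at both, and by `to-b`
        -- and `from-b` this exchanges their neighbourhoods. The paths used by the second mutation
        -- are those of the first reversed, so the arrows created elsewhere cancel.
        μ²-swap : (λ u v → Q₂ (σ u) (σ v)) ≐ Q
        μ²-swap u v
          with toSum (u ≟ a) | toSum (u ≟ b) | toSum (v ≟ a) | toSum (v ≟ b)
        ... | inj₁ ≡.refl | _ | inj₁ ≡.refl | _ rewrite σ-a | Q₂-from-b b = ≡.trans Qbb (≡.sym Qaa)
        ... | inj₁ ≡.refl | _ | inj₂ _ | inj₁ ≡.refl rewrite σ-a | σ-b = Q₂-from-b a
        ... | inj₁ ≡.refl | _ | inj₂ v≢a | inj₂ v≢b rewrite σ-a | σ-fix v≢a v≢b =
          ≡.trans (Q₂-from-b v) (to-b v)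
        ... | inj₂ _ | inj₁ ≡.refl | inj₁ ≡.refl | _ rewrite σ-a | σ-b = Q₂-to-b a
        ... | inj₂ _ | inj₁ ≡.refl | inj₂ _ | inj₁ ≡.refl rewrite σ-b =
          ≡.trans (Q₂-from-a a≢b) (≡.trans Qaa (≡.sym Qbb))
        ... | inj₂ _ | inj₁ ≡.refl | inj₂ v≢a | inj₂ v≢b rewrite σ-b | σ-fix v≢a v≢b =
          ≡.trans (Q₂-from-a v≢b) (≡.sym (from-b v))
        ... | inj₂ u≢a | inj₂ u≢b | inj₁ ≡.refl | _ rewrite σ-a | σ-fix u≢a u≢b =
          ≡.trans (Q₂-to-b u) (from-b u)
        ... | inj₂ u≢a | inj₂ u≢b | inj₂ _ | inj₁ ≡.refl rewrite σ-b | σ-fix u≢a u≢b =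
          ≡.trans (Q₂-to-a u≢b) (≡.sym (to-b u))
        ... | inj₂ u≢a | inj₂ u≢b | inj₂ v≢a | inj₂ v≢b
          rewrite σ-fix u≢a u≢b | σ-fix v≢a v≢b
                | μ-else (μ a Q) u≢b v≢b | μ-else Q u≢a v≢a | μ-else Q v≢a u≢a
                | μa-to-b u | μa-to-b v | μa-from-b u | μa-from-b v
                | to-b u | to-b v | from-b u | from-b v
                | ℕ.*-comm (Q a u) (Q v a) | ℕ.*-comm (Q a v) (Q u a)
          = μ-cancel {Q} (reduced circle) (Q u a ℕ.* Q a v) (Q v a ℕ.* Q a u)

-- y-variables along the circle

-- A substitute for division in the presence of zero. `Pos-+` admits an arbitrary second summand
-- because a sum of subtraction-free expressions cannot vanish unless both do.
record CancellativeElements {r ℓ} p (R : CommutativeSemiring r ℓ) : Set (Level.suc p ⊔ r ⊔ ℓ) where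
  open CommutativeSemiring R
  field
    Pos        : Carrier → Set p
    Pos-1      : Pos 1#
    Pos-+      : ∀ {x} y → Pos x → Pos (x + y)
    Pos-*      : ∀ {x y} → Pos x → Pos y → Pos (x * y)
    Pos-cancel : ∀ {x a b} → Pos x → x * a ≈ x * b → a ≈ b

module Dynamics {r ℓ p} (R : CommutativeSemiring r ℓ) (cancellative : CancellativeElements p R)
  {V : Set} (_≟_ : ∀ (u v : V) → Dec (u ≡ v))
  (c : ℕ → V) (M : ℕ) (c-injective : ∀ {i j} → i ≤ M → j ≤ M → c i ≡ c j → i ≡ j)
  where

  open CommutativeSemiring R
  open CancellativeElements cancellative public
  open import Relation.Binary.Reasoning.Setoid setoid
  open import Algebra.Solver.Ring.NaturalCoefficients.Default R
  open WindowSums R public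
  open QuiverMutation _≟_ public
  open Circle c M c-injective public
  open Chord
  open CircleQuiver

  -- Mutation with denominators cleared, restricted to at most one arrow at `k`. The form of
  -- `out-of` comes from 1 / (1 + 1/y) = y / (1 + y).
  record Mutates (k : V) (Q : Quiver V) (y y′ : V → Carrier) : Set ℓ where
    field
      at-k    : y k * y′ k ≈ 1#
      neutral : ∀ {v} → v ≢ k → Q v k ≡ 0 × Q k v ≡ 0 → y′ v ≈ y v
      into    : ∀ {v} → v ≢ k → Q v k ≡ 1 × Q k v ≡ 0 → y′ v ≈ y v * (1# + y k)
      out-of  : ∀ {v} → v ≢ k → Q v k ≡ 0 × Q k v ≡ 1 → (1# + y k) * y′ v ≈ y v * y k
  open Mutates

  Mutates-cong : ∀ {k Q Q′ y y′} → Q ≐ Q′ → Mutates k Q y y′ → Mutates k Q′ y y′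
  Mutates-cong {k} {Q} {Q′} Q≐ m = record
    { at-k    = at-k m
    ; neutral = λ v≢k → neutral m v≢k ∘ back
    ; into    = λ v≢k → into m v≢k ∘ back
    ; out-of  = λ v≢k → out-of m v≢k ∘ back
    }
    where
    back : ∀ {v i j} → Q′ v k ≡ i × Q′ k v ≡ j → Q v k ≡ i × Q k v ≡ j
    back (e , f) = ≡.trans (Q≐ _ _) e , ≡.trans (Q≐ _ _) f

  ∏-Pos : ∀ {f} lo hi → (∀ j → Pos (f j)) → Pos (∏ f lo hi)
  ∏-Pos {f} lo hi f-Pos = go lo (hi ∸ lo)
    where
    go : ∀ l k → Pos (prodFrom f l k)
    go l zero    = Pos-1
    go l (suc k) = Pos-* (f-Pos l) (go (suc l) k)

  W-start-Pos : ∀ s z → s ≤ M → Pos (W s M z s)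
  W-start-Pos s z s≤M = ≡.subst Pos
    (cong (_+ ∏ z s (suc M) * ∑ (∏ z s) s s) (≡.sym (∑-head (∏ z s) (s≤s s≤M))))
    (Pos-+ _ (Pos-+ _ (≡.subst Pos (≡.sym (∏-empty z s)) Pos-1)))

  -- The index `β` is lifted to the first position not before `α` on the unrolled cycle. For `β < α`
  -- this lies one period further on, where the window has gained the factor p n.
  target : ℕ → (ℕ → Carrier) → ℕ → ℕ → Carrier
  target s z α β =
    if does (α ℕ.≤? β) then W s M z (suc β) else ∏ z s (suc M) * W s M z (suc β)

  target-≤ : ∀ s z {α β} → α ≤ β → target s z α β ≡ W s M z (suc β)
  target-≤ s z {α} {β} α≤β rewrite dec-true (α ℕ.≤? β) α≤β = ≡.refl

  target-> : ∀ s z {α β} → β < α → target s z α β ≡ ∏ z s (suc M) * W s M z (suc β)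
  target-> s z {α} {β} β<α rewrite dec-false (α ℕ.≤? β) (ℕ.<⇒≱ β<α) = ≡.refl

  -- The effect on the y-variables of the composite μ s ⋯ μ (M ∸ 2) σ μ M ⋯ μ s.
  record Evolved (s : ℕ) (Q : Quiver V) (y y′ : V → Carrier) : Set ℓ where
    field
      on-circle : ∀ {i} → s ≤ i → i < M →
        y′ (c i) * W s M (y ∘ c) (suc (suc i)) ≈ y (c i) * W s M (y ∘ c) i
      at-last   :
        y′ (c M) * (∏ (y ∘ c) s (suc M) * W s M (y ∘ c) (suc s)) ≈ y (c M) * W s M (y ∘ c) M
      off-circle : ∀ {v α β} → Outside s v → Chord s Q v α β →
        W s M (y ∘ c) (suc α) * y′ v ≈ y v * target s (y ∘ c) α β
  open Evolved

  -- Base case: a cycle of two vertices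

  module Base {s} (M≡1+s : M ≡ suc s) {Q} (circle : CircleQuiver s Q)
    (σ : V → V) (σ-a : σ (c s) ≡ c M) (σ-b : σ (c M) ≡ c s)
    (σ-fix : ∀ {v} → v ≢ c s → v ≢ c M → σ v ≡ v)
    {y y₁ y₂ y′ : V → Carrier} (m₁ : Mutates (c s) Q y y₁)
    (m₂ : Mutates (c M) (μ (c s) Q) y₁ y₂) (y′-def : ∀ v → y′ v ≡ y₂ (σ v))
    where

    open LastTwo M≡1+s circle

    private
      a = c s
      b = c M
      z = y ∘ c

      s<M : s < M
      s<M = ℕ.≤-reflexive (≡.sym M≡1+s)

      b≢a : b ≢ a
      b≢a = a≢b ∘ ≡.sym

      Y = ∏ z s (suc M)

      Y≈ : Y ≈ y a * y b
      Y≈ = trans (∏-last z (ℕ.<⇒≤ s<M))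
        (*-congʳ (trans (reflexive (cong (∏ z s) M≡1+s)) (∏-singleton z s)))

      Ws≈ : W s M z s ≈ 1# + y a
      Ws≈ = begin
        W s M z s
          ≡⟨ ≡.cong₂ (λ e f → e + Y * f) (∑-head (∏ z s) (ℕ.m≤n⇒m≤1+n s<M)) (∑-empty (∏ z s) s) ⟩
        (∏ z s s + ∑ (∏ z s) (suc s) (suc M)) + Y * 0#
          ≡⟨ cong (λ e → (∏ z s s + e) + Y * 0#) (∑-head (∏ z s) (s≤s s<M)) ⟩
        (∏ z s s + (∏ z s (suc s) + ∑ (∏ z s) (suc (suc s)) (suc M))) + Y * 0#
          ≡⟨ ≡.cong₂ (λ e f → (e + (∏ z s (suc s) + f)) + Y * 0#) (∏-empty z s)
             (≡.trans (cong (λ m → ∑ (∏ z s) (suc m) (suc M)) (≡.sym M≡1+s)) (∑-empty (∏ z s) (suc M))) ⟩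
        (1# + (∏ z s (suc s) + 0#)) + Y * 0#
          ≈⟨ solve 2 (λ u v → (con 1 :+ (u :+ con 0)) :+ v :* con 0 := con 1 :+ u) refl _ _ ⟩
        1# + ∏ z s (suc s)
          ≈⟨ +-congˡ (∏-singleton z s) ⟩
        1# + y a ∎

      W-total : ∀ {i} → i ≡ suc M → W s M z i ≈ Y * W s M z s
      W-total ≡.refl = W-last s M z

      -- Both other windows of the three-term relation are known, since `suc (suc s)` is a full
      -- period after `s`; cancelling `1# + y a` then yields the window at `suc s`.
      W₁≈ : (1# + y a) * W s M z (suc s) ≈ (1# + y a) * (y a * (1# + y b))
      W₁≈ = begin
        (1# + y a) * W s M z (suc s)
          ≈⟨ W-three-term z s<M ⟩
        y a * W s M z s + W s M z (suc (suc s))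
          ≈⟨ +-cong (*-congˡ Ws≈) (trans (W-total (cong suc (≡.sym M≡1+s))) (*-cong Y≈ Ws≈)) ⟩
        y a * (1# + y a) + (y a * y b) * (1# + y a)
          ≈⟨ solve 2 (λ u v → u :* (con 1 :+ u) :+ (u :* v) :* (con 1 :+ u)
                            := (con 1 :+ u) :* (u :* (con 1 :+ v))) refl _ _ ⟩
        (1# + y a) * (y a * (1# + y b)) ∎

      1+ya-Pos : Pos (1# + y a)
      1+ya-Pos = Pos-+ (y a) Pos-1

      W₁ : W s M z (suc s) ≈ y a * (1# + y b)
      W₁ = Pos-cancel 1+ya-Pos W₁≈

      y₁b : y₁ b ≈ y b
      y₁b = neutral m₁ b≢a (Qba , Qab)

      y₂a : y₂ a ≈ y₁ a
      y₂a = neutral m₂ a≢b (≡.trans (μa-to-b a) Qab , ≡.trans (μa-from-b a) Qba)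

      y′a : y′ a ≈ y₂ b
      y′a = reflexive (≡.trans (y′-def a) (cong y₂ σ-a))

      y′b : y′ b ≈ y₁ a
      y′b = trans (reflexive (≡.trans (y′-def b) (cong y₂ σ-b))) y₂a

      -- The transposition hands `a` the inverse of `y b`, which removes `y b` from the period
      -- factor.
      inner-eq : ∀ {i} → i ≡ s →
        y′ (c i) * W s M z (suc (suc i)) ≈ y (c i) * W s M z i
      inner-eq ≡.refl = begin
        y′ a * W s M z (suc (suc s))
          ≈⟨ *-cong y′a (trans (W-total (cong suc (≡.sym M≡1+s))) (*-congʳ Y≈)) ⟩
        y₂ b * (y a * y b * W s M z s)
          ≈⟨ solve 4 (λ e f g h → e :* (f :* g :* h) := (g :* e) :* (f :* h)) refl _ _ _ _ ⟩
        y b * y₂ b * (y a * W s M z s)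
          ≈⟨ *-congʳ (trans (*-congʳ (sym y₁b)) (at-k m₂)) ⟩
        1# * (y a * W s M z s)
          ≈⟨ *-identityˡ _ ⟩
        y a * W s M z s ∎

      last-eq : y′ b * (Y * W s M z (suc s)) ≈ y b * W s M z M
      last-eq = begin
        y′ b * (Y * W s M z (suc s))
          ≈⟨ *-cong y′b (*-congʳ Y≈) ⟩
        y₁ a * (y a * y b * W s M z (suc s))
          ≈⟨ solve 4 (λ e f g h → e :* (f :* g :* h) := (f :* e) :* (g :* h)) refl _ _ _ _ ⟩
        y a * y₁ a * (y b * W s M z (suc s))
          ≈⟨ trans (*-congʳ (at-k m₁)) (*-identityˡ _) ⟩
        y b * W s M z (suc s)
          ≡⟨ cong (λ m → y b * W s M z m) M≡1+s ⟨
        y b * W s M z M ∎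

      module _ {v α β} (v∉ : Outside s v) (C : Chord s Q v α β) where
        v≢a : v ≢ a
        v≢a = v∉ ℕ.≤-refl (ℕ.<⇒≤ s<M)

        v≢b : v ≢ b
        v≢b = v∉ (ℕ.<⇒≤ s<M) ℕ.≤-refl

        at-b : ∀ {i j} → Q v a ≡ i × Q a v ≡ j → μ a Q v b ≡ j × μ a Q b v ≡ i
        at-b (e , f) = ≡.trans (μa-to-b v) (≡.trans (to-b v) f)
                     , ≡.trans (μa-from-b v) (≡.trans (from-b v) e)

        y′v : y′ v ≡ y₂ v
        y′v = ≡.trans (y′-def v) (cong y₂ (σ-fix v≢a v≢b))

        unchanged : Q v a ≡ 0 × Q a v ≡ 0 → y′ v ≈ y v
        unchanged e = trans (reflexive y′v)
          (trans (neutral m₂ v≢b (at-b e)) (neutral m₁ v≢a e))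

      off-eq : ∀ {v α β} → Outside s v → Chord s Q v α β →
        W s M z (suc α) * y′ v ≈ y v * target s z α β
      off-eq {v} {α} v∉ C
        with first-or-last (s≤α C) (α≤M C) | first-or-last (s≤β C) (β≤M C)
      ... | inj₁ ≡.refl | inj₁ ≡.refl rewrite target-≤ s z (ℕ.≤-refl {s}) =
        trans (*-congˡ (unchanged v∉ C (chord-both C ≡.refl ≡.refl))) (*-comm _ _)
      ... | inj₂ ≡.refl | inj₂ ≡.refl rewrite target-≤ s z (ℕ.≤-refl {M}) =
        trans (*-congˡ (unchanged v∉ C (chord-neutral C (ℕ.<⇒≢ s<M) (ℕ.<⇒≢ s<M)))) (*-comm _ _)
      ... | inj₁ ≡.refl | inj₂ ≡.refl rewrite target-≤ s z (ℕ.<⇒≤ s<M) = begin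
        W s M z (suc s) * y′ v
          ≈⟨ *-cong (trans W₁ (*-congˡ (+-congˡ (sym y₁b)))) (reflexive (y′v v∉ C)) ⟩
        y a * (1# + y₁ b) * y₂ v
          ≈⟨ *-assoc _ _ _ ⟩
        y a * ((1# + y₁ b) * y₂ v)
          ≈⟨ *-congˡ (out-of m₂ (v≢b v∉ C) (at-b v∉ C e)) ⟩
        y a * (y₁ v * y₁ b)
          ≈⟨ *-congˡ (*-cong (into m₁ (v≢a v∉ C) e) y₁b) ⟩
        y a * (y v * (1# + y a) * y b)
          ≈⟨ solve 4 (λ f g h i → f :* (g :* h :* i) := g :* (f :* i :* h)) refl _ _ _ _ ⟩
        y v * (y a * y b * (1# + y a))
          ≈⟨ *-congˡ (sym (trans (W-last s M z) (*-cong Y≈ Ws≈))) ⟩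
        y v * W s M z (suc M) ∎
        where e = chord-to C ≡.refl (ℕ.<⇒≢ s<M)
      ... | inj₂ ≡.refl | inj₁ ≡.refl rewrite target-> s z s<M = begin
        W s M z (suc M) * y′ v
          ≈⟨ *-cong (trans (W-last s M z) (*-congˡ Ws≈))
                    (trans (reflexive (y′v v∉ C)) (into m₂ (v≢b v∉ C) (at-b v∉ C e))) ⟩
        Y * (1# + y a) * (y₁ v * (1# + y₁ b))
          ≈⟨ solve 4 (λ f g h i → f :* g :* (h :* i) := g :* h :* (f :* i)) refl _ _ _ _ ⟩
        (1# + y a) * y₁ v * (Y * (1# + y₁ b))
          ≈⟨ *-cong (out-of m₁ (v≢a v∉ C) e) (*-congˡ (+-congˡ y₁b)) ⟩
        y v * y a * (Y * (1# + y b))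
          ≈⟨ solve 4 (λ f g h i → f :* g :* (h :* i) := f :* (h :* (g :* i))) refl _ _ _ _ ⟩
        y v * (Y * (y a * (1# + y b)))
          ≈⟨ *-congˡ (*-congˡ (sym W₁)) ⟩
        y v * (Y * W s M z (suc s)) ∎
        where e = chord-from C (ℕ.<⇒≢ s<M) ≡.refl

    evolved : Evolved s Q y y′
    evolved = record
      { on-circle = λ s≤i i<M → inner-eq (ℕ.≤-antisym
          (ℕ.≤-pred (ℕ.≤-trans i<M (ℕ.≤-reflexive M≡1+s))) s≤i)
      ; at-last = last-eq
      ; off-circle = off-eq
      }

  -- Induction step: enclosing the shorter composite between two mutations at `c s`

  module Step {s} (1+s<M : suc s < M) {Q} (circle : CircleQuiver s Q)
    {y ŷ ỹ y′ : V → Carrier} (m₁ : Mutates (c s) Q y ŷ)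
    (ev : Evolved (suc s) (μ (c s) Q) ŷ ỹ) (m₂ : Mutates (c s) (μ (c s) Q) ỹ y′)
    (y-Pos : ∀ v → Pos (y v))
    where

    open MutateFirst 1+s<M circle

    private
      k = c s
      z = y ∘ c
      ẑ = ŷ ∘ c
      q = y k
      Y = ∏ z s (suc M)
      Ŷ = ∏ ẑ (suc s) (suc M)
      w = W s M z
      ŵ = W (suc s) M ẑ

      s<M : s < M
      s<M = ℕ.<⇒≤ 1+s<M

      q-Pos : Pos q
      q-Pos = y-Pos k

      1+q-Pos : Pos (1# + q)
      1+q-Pos = Pos-+ q Pos-1

      Y-Pos : Pos Y
      Y-Pos = ∏-Pos s (suc M) (λ j → y-Pos (c j))

      ws-Pos : Pos (w s)
      ws-Pos = W-start-Pos s z (ℕ.<⇒≤ s<M)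

      c≢k : ∀ {j} → suc s ≤ j → j ≤ M → c j ≢ k
      c≢k = c-≢

      μ-flip : ∀ {v i j} → Q v k ≡ i × Q k v ≡ j → μ k Q v k ≡ j × μ k Q k v ≡ i
      μ-flip (e , f) = ≡.trans (μ-to k Q _) f , ≡.trans (μ-from k Q _) e

      second-edge : Q (c (suc s)) k ≡ 0 × Q k (c (suc s)) ≡ 1
      second-edge = chord-from (middle circle ℕ.≤-refl 1+s<M) (ℕ.<⇒≢ (s≤s (ℕ.n≤1+n s))) ≡.refl

      middle-edge : ∀ {i} → suc s < i → i < M → Q (c i) k ≡ 0 × Q k (c i) ≡ 0
      middle-edge {suc i} (s≤s s<i) 1+i<M =
        chord-neutral (middle circle (ℕ.<⇒≤ s<i) 1+i<M)
          (ℕ.<⇒≢ (ℕ.m≤n⇒m≤1+n (ℕ.m≤n⇒m≤1+n s<i))) (ℕ.<⇒≢ s<i)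

      last-edge : Q (c M) k ≡ 1 × Q k (c M) ≡ 0
      last-edge = chord-to (last circle) ≡.refl s≢pred-M

      ẑ-first : (1# + q) * ẑ (suc s) ≈ q * z (suc s)
      ẑ-first = trans (out-of m₁ (c≢k ℕ.≤-refl s<M) second-edge) (*-comm _ _)

      ẑ-last : ẑ M ≈ z M * (1# + q)
      ẑ-last = into m₁ (c≢k s<M ℕ.≤-refl) last-edge

      ẑ-mid : ∀ {j} → suc s < j → j < M → ẑ j ≈ z j
      ẑ-mid 1+s<j j<M =
        neutral m₁ (c≢k (ℕ.<⇒≤ 1+s<j) (ℕ.<⇒≤ j<M)) (middle-edge 1+s<j j<M)

      open Shrink z ẑ 1+s<M ẑ-first ẑ-last ẑ-mid

      2+s≤1+M : suc (suc s) ≤ suc M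
      2+s≤1+M = s≤s s<M

      -- After the first mutation `k` lies off the shorter cycle, attached by the chord with ends
      -- `M` and `suc s`, so the induction hypothesis also evaluates its variable.
      ỹk-eq : w s * (ỹ k * q) ≈ w (suc (suc s))
      ỹk-eq = Pos-cancel Y-Pos (begin
        Y * (w s * (ỹ k * q))
          ≈⟨ sym (*-assoc _ _ _) ⟩
        Y * w s * (ỹ k * q)
          ≈⟨ *-congʳ (trans (sym (W-last s M z)) (sym (W-shrink 2+s≤1+M ℕ.≤-refl))) ⟩
        (1# + q) * ŵ (suc M) * (ỹ k * q)
          ≈⟨ solve 4 (λ f g h i → f :* g :* (h :* i) := f :* i :* (g :* h)) refl _ _ _ _ ⟩
        (1# + q) * q * (ŵ (suc M) * ỹ k)
          ≈⟨ *-congˡ (off-circle ev (λ s<j j≤M → c≢k s<j j≤M ∘ ≡.sym) μ-chord-k) ⟩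
        (1# + q) * q * (ŷ k * target (suc s) ẑ M (suc s))
          ≡⟨ cong (λ e → (1# + q) * q * (ŷ k * e)) (target-> (suc s) ẑ 1+s<M) ⟩
        (1# + q) * q * (ŷ k * (Ŷ * ŵ (suc (suc s))))
          ≈⟨ solve 5 (λ f g h i j → f :* g :* (h :* (i :* j)) := g :* h :* (i :* (f :* j)))
               refl _ _ _ _ _ ⟩
        q * ŷ k * (Ŷ * ((1# + q) * ŵ (suc (suc s))))
          ≈⟨ *-cong (at-k m₁) (*-cong ∏-total (W-shrink ℕ.≤-refl 2+s≤1+M)) ⟩
        1# * (Y * w (suc (suc s)))
          ≈⟨ *-identityˡ _ ⟩
        Y * w (suc (suc s)) ∎)

      -- Here the three-term relation enters: it turns the sum contributed by the second mutation at
      -- `k` into a product.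
      1+ỹk-eq : (1# + ỹ k) * (w s * q) ≈ (1# + q) * w (suc s)
      1+ỹk-eq = begin
        (1# + ỹ k) * (w s * q)
          ≈⟨ solve 3 (λ f g h → (con 1 :+ f) :* (g :* h) := h :* g :+ g :* (f :* h)) refl _ _ _ ⟩
        q * w s + w s * (ỹ k * q)
          ≈⟨ +-congˡ ỹk-eq ⟩
        q * w s + w (suc (suc s))
          ≈⟨ sym (W-three-term z s<M) ⟩
        (1# + q) * w (suc s) ∎

      -- The first mutation reversed the arrows at `k`, so a vertex that `k` pointed to now points
      -- to `k`.
      y′-into : ∀ {v} → v ≢ k → Q v k ≡ 0 × Q k v ≡ 1 →
        y′ v * (w s * q) ≈ ỹ v * ((1# + q) * w (suc s))
      y′-into v≢k e = trans (*-congʳ (into m₂ v≢k (μ-flip e)))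
        (trans (*-assoc _ _ _) (*-congˡ 1+ỹk-eq))

      y′-out-of : ∀ {v} → v ≢ k → Q v k ≡ 1 × Q k v ≡ 0 →
        (1# + q) * (w (suc s) * y′ v) ≈ ỹ v * w (suc (suc s))
      y′-out-of {v} v≢k e = begin
        (1# + q) * (w (suc s) * y′ v)
          ≈⟨ sym (*-assoc _ _ _) ⟩
        (1# + q) * w (suc s) * y′ v
          ≈⟨ *-congʳ (sym 1+ỹk-eq) ⟩
        (1# + ỹ k) * (w s * q) * y′ v
          ≈⟨ solve 3 (λ f g h → f :* g :* h := f :* h :* g) refl _ _ _ ⟩
        (1# + ỹ k) * y′ v * (w s * q)
          ≈⟨ *-congʳ (out-of m₂ v≢k (μ-flip e)) ⟩
        ỹ v * ỹ k * (w s * q)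
          ≈⟨ solve 4 (λ f g h i → f :* g :* (h :* i) := f :* (h :* (g :* i))) refl _ _ _ _ ⟩
        ỹ v * (w s * (ỹ k * q))
          ≈⟨ *-congˡ ỹk-eq ⟩
        ỹ v * w (suc (suc s)) ∎

      y′-neutral : ∀ {v} → v ≢ k → Q v k ≡ 0 × Q k v ≡ 0 → y′ v ≈ ỹ v
      y′-neutral v≢k (e , f) = neutral m₂ v≢k (μ-flip (e , f))

      first-eq : y′ k * w (suc (suc s)) ≈ y k * w s
      first-eq = begin
        y′ k * w (suc (suc s))
          ≈⟨ *-congˡ (sym ỹk-eq) ⟩
        y′ k * (w s * (ỹ k * q))
          ≈⟨ solve 4 (λ f g h i → f :* (g :* (h :* i)) := h :* f :* (i :* g)) refl _ _ _ _ ⟩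
        ỹ k * y′ k * (q * w s)
          ≈⟨ trans (*-congʳ (at-k m₂)) (*-identityˡ _) ⟩
        q * w s ∎

      second-eq : y′ (c (suc s)) * w (suc (suc (suc s))) ≈ y (c (suc s)) * w (suc s)
      second-eq = Pos-cancel (Pos-* ws-Pos q-Pos) (begin
        w s * q * (y′ v * w 3+s)
          ≈⟨ solve 4 (λ f g h i → f :* g :* (h :* i) := h :* (f :* g) :* i) refl _ _ _ _ ⟩
        y′ v * (w s * q) * w 3+s
          ≈⟨ *-congʳ (y′-into (c≢k ℕ.≤-refl s<M) second-edge) ⟩
        ỹ v * ((1# + q) * w (suc s)) * w 3+s
          ≈⟨ *-congˡ (sym (W-shrink (ℕ.n≤1+n _) (s≤s 1+s<M))) ⟩
        ỹ v * ((1# + q) * w (suc s)) * ((1# + q) * ŵ 3+s)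
          ≈⟨ solve 4 (λ f g h i → f :* (g :* h) :* (g :* i) := g :* g :* h :* (f :* i)) refl _ _ _ _ ⟩
        (1# + q) * (1# + q) * w (suc s) * (ỹ v * ŵ 3+s)
          ≈⟨ *-congˡ (on-circle ev ℕ.≤-refl 1+s<M) ⟩
        (1# + q) * (1# + q) * w (suc s) * (ŷ v * ŵ (suc s))
          ≈⟨ solve 4 (λ f g h i → f :* f :* g :* (h :* i) := f :* h :* (g :* (f :* i))) refl _ _ _ _ ⟩
        (1# + q) * ŷ v * (w (suc s) * ((1# + q) * ŵ (suc s)))
          -- The first window of the shorter cycle becomes `w s`, which cancels the denominator left
          -- by `y′-into`.
          ≈⟨ *-cong ẑ-first (*-congˡ W-shrink-first) ⟩
        q * y v * (w (suc s) * w s)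
          ≈⟨ solve 4 (λ f g h i → f :* g :* (h :* i) := i :* f :* (g :* h)) refl _ _ _ _ ⟩
        w s * q * (y v * w (suc s)) ∎)
        where
        v = c (suc s)
        3+s = suc (suc (suc s))

      middle-eq : ∀ {i} → suc s < i → i < M →
        y′ (c i) * w (suc (suc i)) ≈ y (c i) * w i
      middle-eq {i} 1+s<i i<M = begin
        y′ v * w (suc (suc i))
          ≈⟨ *-cong (y′-neutral v≢k e) (sym (W-shrink
               (ℕ.m≤n⇒m≤1+n (ℕ.m≤n⇒m≤1+n 1+s<i)) (s≤s i<M))) ⟩
        ỹ v * ((1# + q) * ŵ (suc (suc i)))
          ≈⟨ solve 3 (λ f g h → f :* (g :* h) := g :* (f :* h)) refl _ _ _ ⟩
        (1# + q) * (ỹ v * ŵ (suc (suc i)))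
          ≈⟨ *-congˡ (on-circle ev (ℕ.<⇒≤ 1+s<i) i<M) ⟩
        (1# + q) * (ŷ v * ŵ i)
          ≈⟨ solve 3 (λ f g h → f :* (g :* h) := g :* (f :* h)) refl _ _ _ ⟩
        ŷ v * ((1# + q) * ŵ i)
          ≈⟨ *-cong (ẑ-mid 1+s<i i<M) (W-shrink 1+s<i (ℕ.m≤n⇒m≤1+n (ℕ.<⇒≤ i<M))) ⟩
        y v * w i ∎
        where
        v = c i
        v≢k = c≢k (ℕ.<⇒≤ 1+s<i) (ℕ.<⇒≤ i<M)
        e = middle-edge 1+s<i i<M

      last-eq : y′ (c M) * (Y * w (suc s)) ≈ y (c M) * w M
      last-eq = Pos-cancel 1+q-Pos (begin
        (1# + q) * (y′ v * (Y * w (suc s)))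
          ≈⟨ solve 4 (λ f g h i → f :* (g :* (h :* i)) := h :* (f :* (i :* g))) refl _ _ _ _ ⟩
        Y * ((1# + q) * (w (suc s) * y′ v))
          ≈⟨ *-congˡ (y′-out-of (c≢k s<M ℕ.≤-refl) last-edge) ⟩
        Y * (ỹ v * w (suc (suc s)))
          ≈⟨ *-cong (sym ∏-total) (*-congˡ (sym (W-shrink ℕ.≤-refl 2+s≤1+M))) ⟩
        Ŷ * (ỹ v * ((1# + q) * ŵ (suc (suc s))))
          ≈⟨ solve 4 (λ f g h i → f :* (g :* (h :* i)) := h :* (g :* (f :* i))) refl _ _ _ _ ⟩
        (1# + q) * (ỹ v * (Ŷ * ŵ (suc (suc s))))
          ≈⟨ *-congˡ (at-last ev) ⟩
        (1# + q) * (ŷ v * ŵ M)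
          ≈⟨ solve 3 (λ f g h → f :* (g :* h) := g :* (f :* h)) refl _ _ _ ⟩
        ŷ v * ((1# + q) * ŵ M)
          ≈⟨ *-cong ẑ-last (W-shrink 1+s<M (ℕ.n≤1+n M)) ⟩
        y v * (1# + q) * w M
          ≈⟨ solve 3 (λ f g h → f :* g :* h := g :* (f :* h)) refl _ _ _ ⟩
        (1# + q) * (y v * w M) ∎)
        where v = c M

      circle-eq : ∀ {i} → s ≤ i → i < M → y′ (c i) * w (suc (suc i)) ≈ y (c i) * w i
      circle-eq s≤i i<M with ℕ.m≤n⇒m<n∨m≡n s≤i
      ... | inj₂ ≡.refl = first-eq
      ... | inj₁ s<i with ℕ.m≤n⇒m<n∨m≡n s<i
      ...   | inj₂ ≡.refl = second-eq
      ...   | inj₁ 1+s<i  = middle-eq 1+s<i i<M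

      target-shrink : ∀ {α β} → s < β → β ≤ M →
        (1# + q) * target (suc s) ẑ α β ≈ target s z α β
      target-shrink {α} {β} s<β β≤M with ℕ.≤-<-connex α β
      ... | inj₁ α≤β rewrite target-≤ (suc s) ẑ α≤β | target-≤ s z α≤β =
        W-shrink (s≤s s<β) (s≤s β≤M)
      ... | inj₂ β<α rewrite target-> (suc s) ẑ β<α | target-> s z β<α = begin
        (1# + q) * (Ŷ * ŵ (suc β))
          ≈⟨ solve 3 (λ f g h → f :* (g :* h) := g :* (f :* h)) refl _ _ _ ⟩
        Ŷ * ((1# + q) * ŵ (suc β))
          ≈⟨ *-cong ∏-total (W-shrink (s≤s s<β) (s≤s β≤M)) ⟩
        Y * w (suc β) ∎

      -- The induction hypothesis for ỹ v, rescaled by 1# + q.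
      off-shrink : ∀ {v α β} → Outside s v → s < α → α ≤ M → s < β → β ≤ M →
        Chord (suc s) (μ k Q) v α β → w (suc α) * ỹ v ≈ ŷ v * target s z α β
      off-shrink {v} {α} {β} v∉ s<α α≤M s<β β≤M C = begin
        w (suc α) * ỹ v
          ≈⟨ *-congʳ (sym (W-shrink (s≤s s<α) (s≤s α≤M))) ⟩
        (1# + q) * ŵ (suc α) * ỹ v
          ≈⟨ *-assoc _ _ _ ⟩
        (1# + q) * (ŵ (suc α) * ỹ v)
          ≈⟨ *-congˡ (off-circle ev (λ s<j → v∉ (ℕ.<⇒≤ s<j)) C) ⟩
        (1# + q) * (ŷ v * target (suc s) ẑ α β)
          ≈⟨ solve 3 (λ f g h → f :* (g :* h) := g :* (f :* h)) refl _ _ _ ⟩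
        ŷ v * ((1# + q) * target (suc s) ẑ α β)
          ≈⟨ *-congˡ (target-shrink {α} s<β β≤M) ⟩
        ŷ v * target s z α β ∎

      off-eq : ∀ {v α β} → Outside s v → Chord s Q v α β →
        w (suc α) * y′ v ≈ y v * target s z α β
      off-eq {v} {α} {β} v∉ C with toSum (s ℕ.≟ α) | toSum (s ℕ.≟ β)
      ... | inj₂ s≢α | inj₂ s≢β = begin
        w (suc α) * y′ v
          ≈⟨ *-congˡ (y′-neutral v≢k e) ⟩
        w (suc α) * ỹ v
          ≈⟨ off-shrink v∉ (ℕ.≤∧≢⇒< (s≤α C) s≢α) (α≤M C) (ℕ.≤∧≢⇒< (s≤β C) s≢β) (β≤M C)
               (μ-chord-neutral v≢k C s≢α s≢β) ⟩
        ŷ v * target s z α β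
          ≈⟨ *-congʳ (neutral m₁ v≢k e) ⟩
        y v * target s z α β ∎
        where
        v≢k = v∉ ℕ.≤-refl (ℕ.<⇒≤ s<M)
        e = chord-neutral C s≢α s≢β
      -- The induction hypothesis is applied with the substitute ends `M` and `M`; both windows are
      -- then `w (suc M)`, cancelled in the form `Y * w s`.
      ... | inj₁ ≡.refl | inj₁ ≡.refl rewrite target-≤ s z (ℕ.≤-refl {s}) =
        trans (*-comm _ _) (*-congʳ (Pos-cancel (Pos-* Y-Pos ws-Pos) (begin
          Y * w s * y′ v
            ≈⟨ *-cong (sym (W-last s M z)) (y′-neutral v≢k e) ⟩
          w (suc M) * ỹ v
            ≈⟨ off-shrink v∉ s<M ℕ.≤-refl s<M ℕ.≤-refl (μ-chord-both v≢k C ≡.refl ≡.refl) ⟩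
          ŷ v * target s z M M
            ≡⟨ cong (ŷ v *_) (target-≤ s z (ℕ.≤-refl {M})) ⟩
          ŷ v * w (suc M)
            ≈⟨ *-cong (neutral m₁ v≢k e) (W-last s M z) ⟩
          y v * (Y * w s)
            ≈⟨ *-comm _ _ ⟩
          Y * w s * y v ∎)))
        where
        v≢k = v∉ ℕ.≤-refl (ℕ.<⇒≤ s<M)
        e = chord-both C ≡.refl ≡.refl
      -- The first mutation contributes `1# + q`; the second trades the window at `suc (suc s)` for
      -- the one at `suc s`.
      ... | inj₁ ≡.refl | inj₂ s≢β rewrite target-≤ s z (s≤β C) = Pos-cancel 1+q-Pos (begin
        (1# + q) * (w (suc s) * y′ v)
          ≈⟨ y′-out-of v≢k e ⟩
        ỹ v * w (suc (suc s))
          ≈⟨ *-comm _ _ ⟩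
        w (suc (suc s)) * ỹ v
          ≈⟨ off-shrink v∉ ℕ.≤-refl s<M s<β (β≤M C) (μ-chord-to v≢k C ≡.refl s≢β) ⟩
        ŷ v * target s z (suc s) β
          ≡⟨ cong (ŷ v *_) (target-≤ s z s<β) ⟩
        ŷ v * w (suc β)
          ≈⟨ *-congʳ (into m₁ v≢k e) ⟩
        y v * (1# + q) * w (suc β)
          ≈⟨ solve 3 (λ f g h → f :* g :* h := g :* (f :* h)) refl _ _ _ ⟩
        (1# + q) * (y v * w (suc β)) ∎)
        where
        v≢k = v∉ ℕ.≤-refl (ℕ.<⇒≤ s<M)
        e = chord-to C ≡.refl s≢β
        s<β = ℕ.≤∧≢⇒< (s≤β C) s≢β
      -- `β` moves to `M`, whose window is `Y * w s`. The second mutation cancels `w s` and leaves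
      -- `Y`, the factor that `target` prescribes for `β < α`.
      ... | inj₂ s≢α | inj₁ ≡.refl rewrite target-> s z (ℕ.≤∧≢⇒< (s≤α C) s≢α) =
        Pos-cancel (Pos-* ws-Pos q-Pos) (begin
        w s * q * (w (suc α) * y′ v)
          ≈⟨ solve 4 (λ f g h i → f :* g :* (h :* i) := h :* (i :* (f :* g))) refl _ _ _ _ ⟩
        w (suc α) * (y′ v * (w s * q))
          ≈⟨ *-congˡ (y′-into v≢k e) ⟩
        w (suc α) * (ỹ v * ((1# + q) * w (suc s)))
          ≈⟨ sym (*-assoc _ _ _) ⟩
        w (suc α) * ỹ v * ((1# + q) * w (suc s))
          ≈⟨ *-congʳ (off-shrink v∉ s<α (α≤M C) s<M ℕ.≤-refl (μ-chord-from v≢k C s≢α ≡.refl)) ⟩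
        ŷ v * target s z α M * ((1# + q) * w (suc s))
          ≡⟨ cong (λ e → ŷ v * e * ((1# + q) * w (suc s))) (target-≤ s z (α≤M C)) ⟩
        ŷ v * w (suc M) * ((1# + q) * w (suc s))
          ≈⟨ *-congʳ (*-congˡ (W-last s M z)) ⟩
        ŷ v * (Y * w s) * ((1# + q) * w (suc s))
          ≈⟨ solve 5 (λ f g h i j → f :* (g :* h) :* (i :* j) := i :* f :* (g :* h :* j))
               refl _ _ _ _ _ ⟩
        (1# + q) * ŷ v * (Y * w s * w (suc s))
          ≈⟨ *-congʳ (out-of m₁ v≢k e) ⟩
        y v * q * (Y * w s * w (suc s))
          ≈⟨ solve 5 (λ f g h i j → f :* g :* (h :* i :* j) := i :* g :* (f :* (h :* j)))
               refl _ _ _ _ _ ⟩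
        w s * q * (y v * (Y * w (suc s))) ∎)
        where
        v≢k = v∉ ℕ.≤-refl (ℕ.<⇒≤ s<M)
        e = chord-from C s≢α ≡.refl
        s<α = ℕ.≤∧≢⇒< (s≤α C) s≢α

    evolved : Evolved s Q y y′
    evolved = record
      { on-circle  = circle-eq
      ; at-last    = last-eq
      ; off-circle = off-eq
      }

-- The semiring of subtraction-free expressions with zero

module WithZero {c ℓ} (F : Semifield c ℓ) where
  open Semifield F
  open Expr F
  private
    module + = IsCommutativeSemigroup +-isCommutativeSemigroup
    module * = IsAbelianGroup *-isAbelianGroup

  ≈₀-refl : ∀ {a} → a ≈₀ a
  ≈₀-refl {just _}  = +.refl
  ≈₀-refl {nothing} = tt

  ≈₀-sym : ∀ {a b} → a ≈₀ b → b ≈₀ a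
  ≈₀-sym {just _}  {just _}  e = +.sym e
  ≈₀-sym {nothing} {nothing} e = tt

  ≈₀-trans : ∀ {a b d} → a ≈₀ b → b ≈₀ d → a ≈₀ d
  ≈₀-trans {just _}  {just _}  {just _}  e f = +.trans e f
  ≈₀-trans {nothing} {nothing} {nothing} e f = tt

  +₀-cong : ∀ {a b d e} → a ≈₀ b → d ≈₀ e → a +₀ d ≈₀ b +₀ e
  +₀-cong {just _}  {just _}  {just _}  {just _}  f g = +.∙-cong f g
  +₀-cong {just _}  {just _}  {nothing} {nothing} f g = f
  +₀-cong {nothing} {nothing} {d}       {e}       f g = g

  +₀-assoc : ∀ a b d → (a +₀ b) +₀ d ≈₀ a +₀ (b +₀ d)
  +₀-assoc nothing  b        d        = ≈₀-refl {b +₀ d}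
  +₀-assoc (just _) nothing  d        = ≈₀-refl {just _ +₀ d}
  +₀-assoc (just _) (just _) nothing  = +.refl
  +₀-assoc (just _) (just _) (just _) = +.assoc _ _ _

  +₀-comm : ∀ a b → a +₀ b ≈₀ b +₀ a
  +₀-comm nothing  nothing  = tt
  +₀-comm nothing  (just _) = +.refl
  +₀-comm (just _) nothing  = +.refl
  +₀-comm (just _) (just _) = +.comm _ _

  +₀-identityʳ : ∀ a → a +₀ 0₀ ≈₀ a
  +₀-identityʳ nothing  = tt
  +₀-identityʳ (just _) = +.refl

  *₀-cong : ∀ {a b d e} → a ≈₀ b → d ≈₀ e → a *₀ d ≈₀ b *₀ e
  *₀-cong {just _}  {just _}  {just _}  {just _}  f g = *.∙-cong f g
  *₀-cong {just _}  {just _}  {nothing} {nothing} f g = tt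
  *₀-cong {nothing} {nothing} {just _}  {just _}  f g = tt
  *₀-cong {nothing} {nothing} {nothing} {nothing} f g = tt

  *₀-assoc : ∀ a b d → (a *₀ b) *₀ d ≈₀ a *₀ (b *₀ d)
  *₀-assoc nothing  nothing  _        = tt
  *₀-assoc nothing  (just _) nothing  = tt
  *₀-assoc nothing  (just _) (just _) = tt
  *₀-assoc (just _) nothing  _        = tt
  *₀-assoc (just _) (just _) nothing  = tt
  *₀-assoc (just _) (just _) (just _) = *.assoc _ _ _

  *₀-comm : ∀ a b → a *₀ b ≈₀ b *₀ a
  *₀-comm nothing  nothing  = tt
  *₀-comm nothing  (just _) = tt
  *₀-comm (just _) nothing  = tt
  *₀-comm (just _) (just _) = *.comm _ _

  *₀-identityˡ : ∀ a → 1₀ *₀ a ≈₀ a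
  *₀-identityˡ nothing  = tt
  *₀-identityˡ (just _) = *.identityˡ _

  *₀-identityʳ : ∀ a → a *₀ 1₀ ≈₀ a
  *₀-identityʳ nothing  = tt
  *₀-identityʳ (just _) = *.identityʳ _

  *₀-distribʳ-+₀ : ∀ a b d → (b +₀ d) *₀ a ≈₀ (b *₀ a) +₀ (d *₀ a)
  *₀-distribʳ-+₀ a        nothing  d        = ≈₀-refl {d *₀ a}
  *₀-distribʳ-+₀ nothing  (just _) nothing  = tt
  *₀-distribʳ-+₀ (just _) (just _) nothing  = +.refl
  *₀-distribʳ-+₀ nothing  (just _) (just _) = tt
  *₀-distribʳ-+₀ (just _) (just _) (just _) = proj₂ distrib _ _ _

  S₀-commutativeSemiring : CommutativeSemiring c ℓ
  S₀-commutativeSemiring = record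
    { Carrier = S₀
    ; _≈_ = _≈₀_
    ; _+_ = _+₀_
    ; _*_ = _*₀_
    ; 0# = 0₀
    ; 1# = 1₀
    ; isCommutativeSemiring = isCommutativeSemiringˡ record
      { +-isCommutativeMonoid = record
        { isMonoid = record
          { isSemigroup = record
            { isMagma = record
              { isEquivalence = isEquivalence
              ; ∙-cong = λ {a} {b} {d} {e} → +₀-cong {a} {b} {d} {e} }
            ; assoc = +₀-assoc }
          ; identity = (λ a → ≈₀-refl {a}) , +₀-identityʳ }
        ; comm = +₀-comm }
      ; *-isCommutativeMonoid = record
        { isMonoid = record
          { isSemigroup = record
            { isMagma = record
              { isEquivalence = isEquivalence
              ; ∙-cong = λ {a} {b} {d} {e} → *₀-cong {a} {b} {d} {e} }
            ; assoc = *₀-assoc }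
          ; identity = *₀-identityˡ , *₀-identityʳ }
        ; comm = *₀-comm }
      ; distribʳ = *₀-distribʳ-+₀
      ; zeroˡ = λ _ → tt
      }
    }
    where
    isEquivalence : IsEquivalence _≈₀_
    isEquivalence = record
      { refl  = λ {a} → ≈₀-refl {a}
      ; sym   = λ {a} {b} → ≈₀-sym {a} {b}
      ; trans = λ {a} {b} {d} → ≈₀-trans {a} {b} {d} }

  NonZero₀ : S₀ → Set c
  NonZero₀ a = ∃ λ u → a ≡ just u

  NonZero₀-+ : ∀ {a} b → NonZero₀ a → NonZero₀ (a +₀ b)
  NonZero₀-+ nothing  (u , ≡.refl) = _ , ≡.refl
  NonZero₀-+ (just _) (u , ≡.refl) = _ , ≡.refl

  NonZero₀-* : ∀ {a b} → NonZero₀ a → NonZero₀ b → NonZero₀ (a *₀ b)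
  NonZero₀-* (u , ≡.refl) (v , ≡.refl) = _ , ≡.refl

  *-cancelˡ : ∀ u {v w} → u * v ≈ u * w → v ≈ w
  *-cancelˡ u = AbelianGroupProperties.∙-cancelˡ
    record { isAbelianGroup = *-isAbelianGroup } u _ _

  *₀-cancel : ∀ {x a b} → NonZero₀ x → x *₀ a ≈₀ x *₀ b → a ≈₀ b
  *₀-cancel {a = just _}  {just _}  (u , ≡.refl) e = *-cancelˡ u e
  *₀-cancel {a = nothing} {nothing} (u , ≡.refl) e = tt

  nonZero₀-cancellative : CancellativeElements c S₀-commutativeSemiring
  nonZero₀-cancellative = record
    { Pos        = NonZero₀
    ; Pos-1      = 1# , ≡.refl
    ; Pos-+      = NonZero₀-+
    ; Pos-*      = NonZero₀-*
    ; Pos-cancel = *₀-cancel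
    }

  ÷₀-unique : ∀ x a b → NonZero₀ b → x *₀ b ≈₀ a → x ≈₀ a ÷₀ b
  ÷₀-unique (just x) (just a) _ (u , ≡.refl) e =
    +.trans (+.sym (*.identityʳ x)) (+.trans (*.∙-congˡ (+.sym (*.inverseʳ u)))
      (+.trans (+.sym (*.assoc x u (u ⁻¹))) (*.∙-congʳ e)))
  ÷₀-unique nothing  nothing  _ (u , ≡.refl) e = tt

-- The composite mutation in a semifield

module Spin {cℓ ℓ} (F : Semifield cℓ ℓ)
  {V : Set} (_≟_ : ∀ (u v : V) → Dec (u ≡ v))
  (c : ℕ → V) (M : ℕ) (c-injective : ∀ {i j} → i ≤ M → j ≤ M → c i ≡ c j → i ≡ j)
  (σ : V → V)
  (σ-a : ∀ {s} → M ≡ suc s → σ (c s) ≡ c M)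
  (σ-b : ∀ {s} → M ≡ suc s → σ (c M) ≡ c s)
  (σ-fix : ∀ {s} → M ≡ suc s → ∀ {v} → v ≢ c s → v ≢ c M → σ v ≡ v)
  where
  open Semifield F
  open Expr F
  open WithZero F public
  open Dynamics S₀-commutativeSemiring nonZero₀-cancellative _≟_ c M c-injective public
  private
    module + = IsCommutativeSemigroup +-isCommutativeSemigroup
    module * = IsAbelianGroup *-isAbelianGroup

  mutate-quiver : ∀ k (S : YSeed F V) → proj₁ (mutate F _≟_ k S) ≐ μ k (proj₁ S)
  mutate-quiver k S i j with does (i ≟ k) | does (j ≟ k)
  ... | true  | _     = ≡.refl
  ... | false | true  = ≡.refl
  ... | false | false = ≡.refl

  mutate-at-k : ∀ k Q (y : V → Carrier) → proj₂ (mutate F _≟_ k (Q , y)) k ≡ y k ⁻¹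
  mutate-at-k k Q y rewrite dec-true (k ≟ k) ≡.refl = ≡.refl

  mutate-off-k : ∀ {k v} Q (y : V → Carrier) → v ≢ k → proj₂ (mutate F _≟_ k (Q , y)) v ≡
    y v * (F ^ ((1# + y k ⁻¹) ⁻¹)) (Q k v) * (F ^ (1# + y k)) (Q v k)
  mutate-off-k {k} {v} Q y v≢k rewrite dec-false (v ≟ k) v≢k = ≡.refl

  -- (1 + y) (1 + y⁻¹)⁻¹ = y, because y (1 + y⁻¹) = 1 + y.
  1+y/1+y⁻¹ : ∀ y → (1# + y) * (1# + y ⁻¹) ⁻¹ ≈ y
  1+y/1+y⁻¹ y = +.trans (*.∙-congʳ (+.sym y[1+y⁻¹]≈1+y))
    (+.trans (*.assoc y _ _) (+.trans (*.∙-congˡ (*.inverseʳ _)) (*.identityʳ y)))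
    where
    y[1+y⁻¹]≈1+y : y * (1# + y ⁻¹) ≈ 1# + y
    y[1+y⁻¹]≈1+y = +.trans (proj₁ distrib y 1# (y ⁻¹))
      (+.trans (+.∙-cong (*.identityʳ y) (*.inverseʳ y)) (+.comm y 1#))

  mutates : ∀ k (S : YSeed F V) →
    Mutates k (proj₁ S) (just ∘ proj₂ S) (just ∘ proj₂ (mutate F _≟_ k S))
  mutates k (Q , y) = record
    { at-k    = +.trans (*.∙-congˡ (*.reflexive (mutate-at-k k Q y))) (*.inverseʳ (y k))
    ; neutral = neutral
    ; into    = into
    ; out-of  = out-of
    }
    where
    y′ = proj₂ (mutate F _≟_ k (Q , y))

    neutral : ∀ {v} → v ≢ k → Q v k ≡ 0 × Q k v ≡ 0 → y′ v ≈ y v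
    neutral {v} v≢k (e , f) rewrite mutate-off-k Q y v≢k | e | f =
      +.trans (*.identityʳ _) (*.identityʳ _)

    into : ∀ {v} → v ≢ k → Q v k ≡ 1 × Q k v ≡ 0 → y′ v ≈ y v * (1# + y k)
    into {v} v≢k (e , f) rewrite mutate-off-k Q y v≢k | e | f =
      *.∙-cong (*.identityʳ _) (*.identityʳ _)

    out-of : ∀ {v} → v ≢ k → Q v k ≡ 0 × Q k v ≡ 1 → (1# + y k) * y′ v ≈ y v * y k
    out-of {v} v≢k (e , f) rewrite mutate-off-k Q y v≢k | e | f =
      +.trans (*.∙-congˡ (+.trans (*.identityʳ _) (*.∙-congˡ (*.identityʳ _))))
        (+.trans (*.comm _ _) (+.trans (*.assoc _ _ _)
          (*.∙-congˡ (+.trans (*.comm _ _) (1+y/1+y⁻¹ (y k))))))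

  CircleQuiver-cong : ∀ {s Q Q′} → Q ≐ Q′ → CircleQuiver s Q → CircleQuiver s Q′
  CircleQuiver-cong Q≐ C = record
    { reduced = Reduced-cong Q≐ reduced
    ; first   = chord-cong Q≐ first
    ; middle  = λ s≤i 1+i<M → chord-cong Q≐ (middle s≤i 1+i<M)
    ; last    = chord-cong Q≐ last
    ; outside = λ v∉ → let α , β , chord-v = outside v∉ in α , β , chord-cong Q≐ chord-v
    }
    where open CircleQuiver C

  Evolved-cong : ∀ {s Q Q′ y y′} → Q ≐ Q′ → Evolved s Q y y′ → Evolved s Q′ y y′
  Evolved-cong Q≐ E = record
    { on-circle  = on-circle
    ; at-last    = at-last
    ; off-circle = λ v∉ C → off-circle v∉ (chord-cong (λ u v → ≡.sym (Q≐ u v)) C)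
    }
    where open Evolved E

  -- The nested form of the composite; `d` counts the vertices from `s` on that precede the last
  -- two.
  spin : ℕ → ℕ → YSeed F V → YSeed F V
  spin s zero    S = relabel F σ (mutate F _≟_ (c (suc s)) (mutate F _≟_ (c s) S))
  spin s (suc d) S = mutate F _≟_ (c s) (spin (suc s) d (mutate F _≟_ (c s) S))

  -- The two conclusions need each other: the closing mutation at `c s` is controlled only because
  -- the inner composite has restored the quiver `μ (c s)` of the original one.
  spin-evolved : ∀ s d S → M ≡ d ℕ.+ suc s → CircleQuiver s (proj₁ S) →
    proj₁ (spin s d S) ≐ proj₁ S ×
    Evolved s (proj₁ S) (just ∘ proj₂ S) (just ∘ proj₂ (spin s d S))
  spin-evolved s zero S ≡.refl circle =
      (λ u v → ≡.trans (mutate-quiver (c M) S₁ (σ u) (σ v))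
        (≡.trans (μ-cong (c M) (mutate-quiver (c s) S) (σ u) (σ v))
          (LastTwo.μ²-swap ≡.refl circle σ (σ-a ≡.refl) (σ-b ≡.refl) (σ-fix ≡.refl) u v)))
    , Base.evolved ≡.refl circle σ (σ-a ≡.refl) (σ-b ≡.refl) (σ-fix ≡.refl)
        (mutates (c s) S)
        (Mutates-cong (mutate-quiver (c s) S) (mutates (c M) S₁)) (λ v → ≡.refl)
    where
    S₁ = mutate F _≟_ (c s) S
  spin-evolved s (suc d) S M≡ circle =
      (λ u v → ≡.trans (mutate-quiver (c s) S₂ u v)
        (≡.trans (μ-cong (c s) S₂≐ u v) (μ-involutive (c s) (proj₁ S) reduced u v)))
    , Step.evolved 1+s<M circle (mutates (c s) S)
        (Evolved-cong (mutate-quiver (c s) S) (proj₂ ih))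
        (Mutates-cong S₂≐ (mutates (c s) S₂)) (λ v → _ , ≡.refl)
    where
    open CircleQuiver circle using (reduced)
    S₁ = mutate F _≟_ (c s) S
    S₂ = spin (suc s) d S₁
    1+s<M : suc s < M
    1+s<M = ≡.subst (suc s <_) (≡.sym M≡) (s≤s (ℕ.m≤n+m (suc s) d))
    ih = spin-evolved (suc s) d S₁ (≡.trans M≡ (≡.sym (ℕ.+-suc d (suc s))))
      (CircleQuiver-cong (λ u v → ≡.sym (mutate-quiver (c s) S u v))
        (MutateFirst.μ-circle 1+s<M circle))
    S₂≐ : proj₁ S₂ ≐ μ (c s) (proj₁ S)
    S₂≐ u v = ≡.trans (proj₁ ih u v) (mutate-quiver (c s) S u v)

-- Spider web quivers

map-tabulate-iterate : ∀ {A : Set} {m} (f : Fin m → A) (g : ℕ → A) s →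
  (∀ i → f i ≡ g (s ℕ.+ toℕ i)) → List.tabulate f ≡ List.map g (List.iterate suc s m)
map-tabulate-iterate {m = zero}  f g s f≗g = ≡.refl
map-tabulate-iterate {m = suc m} f g s f≗g = cong₂ _∷_
  (≡.trans (f≗g Fin.zero) (cong g (ℕ.+-identityʳ s)))
  (map-tabulate-iterate (f ∘ Fin.suc) g (suc s)
    λ i → ≡.trans (f≗g (Fin.suc i)) (cong g (ℕ.+-suc s (toℕ i))))

-- The bound `k + s` keeps its value when `k` drops and the offset `s` grows, so the induction can
-- pass to the tail.
filter-tabulate : ∀ {n m} (f : Fin m → Fin n) s k → (∀ i → toℕ (f i) ≡ s ℕ.+ toℕ i) → k ≤ m →
  List.map toℕ (List.filter (λ i → toℕ i ℕ.<? (k ℕ.+ s)) (List.tabulate f)) ≡ List.iterate suc s k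
filter-tabulate f s zero f≗ k≤m =
  cong (List.map toℕ) (List.filter-none (λ i → toℕ i ℕ.<? s)
    (All.tabulate⁺ λ i → ℕ.≤⇒≯ (≡.subst (s ≤_) (≡.sym (f≗ i)) (ℕ.m≤m+n s (toℕ i)))))
filter-tabulate {m = suc m} f s (suc k) f≗ (s≤s k≤m) = ≡.trans
  (cong (List.map toℕ) (List.filter-accept (λ i → toℕ i ℕ.<? (suc k ℕ.+ s))
    (≡.subst (_< suc k ℕ.+ s) (≡.sym f0≡s) (s≤s (ℕ.m≤n+m s k)))))
  (cong₂ _∷_ f0≡s (≡.trans
    (cong (λ e → List.map toℕ (List.filter (λ i → toℕ i ℕ.<? e) (List.tabulate (f ∘ Fin.suc))))
      (≡.sym (ℕ.+-suc k s)))
    (filter-tabulate (f ∘ Fin.suc) (suc s) k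
      (λ i → ≡.trans (f≗ (Fin.suc i)) (ℕ.+-suc s (toℕ i))) k≤m)))
  where
  f0≡s : toℕ (f Fin.zero) ≡ s
  f0≡s = ≡.trans (f≗ Fin.zero) (ℕ.+-identityʳ s)

count-none : ∀ {r} {f : Fin r → Bool} → (∀ t → f t ≡ false) → count f ≡ 0
count-none {zero}  f≡ = ≡.refl
count-none {suc r} f≡ rewrite f≡ Fin.zero = count-none (f≡ ∘ Fin.suc)

count-single : ∀ {r} (f : Fin r → Bool) t → (∀ t′ → t′ ≢ t → f t′ ≡ false) →
  count f ≡ (if f t then 1 else 0)
count-single f Fin.zero f≡
  rewrite count-none {f = f ∘ Fin.suc} (λ t → f≡ (Fin.suc t) λ ()) = ℕ.+-identityʳ _
count-single f (Fin.suc t) f≡ rewrite f≡ Fin.zero (λ ()) =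
  count-single (f ∘ Fin.suc) t (λ t′ t′≢t → f≡ (Fin.suc t′) (t′≢t ∘ Fin.suc-injective))

toℕ-cyc-< : ∀ {m} (i : Fin m) → suc (toℕ i) < m → toℕ (cyc i) ≡ suc (toℕ i)
toℕ-cyc-< {suc m} i 1+i<m = ≡.trans (Fin.toℕ-fromℕ< _) (m<n⇒m%n≡m 1+i<m)

toℕ-cyc-last : ∀ {m} (i : Fin m) → suc (toℕ i) ≡ m → toℕ (cyc i) ≡ 0
toℕ-cyc-last {suc m} i 1+i≡m =
  ≡.trans (Fin.toℕ-fromℕ< _) (≡.trans (cong (_% suc m) 1+i≡m) (n%n≡0 (suc m)))

<-or-last : ∀ {m} (i : Fin m) → suc (toℕ i) < m ⊎ suc (toℕ i) ≡ m
<-or-last i = ℕ.m≤n⇒m<n∨m≡n (Fin.toℕ<n i)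

cyc-≢ : ∀ {m} → 2 ≤ m → (i : Fin m) → cyc i ≢ i
cyc-≢ 2≤m i eq with <-or-last i
... | inj₁ 1+i<m = ℕ.1+n≢n (≡.trans (≡.sym (toℕ-cyc-< i 1+i<m)) (cong toℕ eq))
... | inj₂ 1+i≡m with ≡.trans (≡.sym (toℕ-cyc-last i 1+i≡m)) (cong toℕ eq)
...   | 0≡i rewrite ≡.sym 0≡i = ℕ.<-irrefl 1+i≡m 2≤m

-- A 2-cycle of circle arrows would return to its start in two steps; three vertices rule this out.
cyc²-≢ : ∀ {m} → 3 ≤ m → (i : Fin m) → cyc (cyc i) ≢ i
cyc²-≢ 3≤m i eq with <-or-last i
... | inj₂ 1+i≡m with toℕ-cyc-last i 1+i≡m
...   | j≡0 with ≡.trans (≡.sym (toℕ-cyc-< (cyc i) (≡.subst (λ j → suc j < _) (≡.sym j≡0)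
                   (ℕ.≤-trans (s≤s (s≤s z≤n)) 3≤m)))) (cong toℕ eq)
...     | 1≡i rewrite j≡0 | ≡.sym 1≡i = ℕ.<-irrefl 1+i≡m 3≤m
cyc²-≢ 3≤m i eq | inj₁ 1+i<m with toℕ-cyc-< i 1+i<m | <-or-last (cyc i)
... | j≡1+i | inj₁ 1+j<m = ℕ.<⇒≢ (s≤s (ℕ.n≤1+n (toℕ i)))
  (≡.trans (≡.sym (cong toℕ eq)) (≡.trans (toℕ-cyc-< (cyc i) 1+j<m) (cong suc j≡1+i)))
... | j≡1+i | inj₂ 1+j≡m with ≡.trans (≡.sym (toℕ-cyc-last (cyc i) 1+j≡m)) (cong toℕ eq)
...   | 0≡i rewrite j≡1+i | ≡.sym 0≡i = ℕ.<-irrefl 1+j≡m 3≤m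

circle-arrows : (m : ℕ) → Fin m → Fin m → ℕ
circle-arrows m i j = if does (3 ℕ.≤? m) then δ (toℕ j) (toℕ (cyc i)) else 0

circle-arrows-reduced : ∀ m i j →
  circle-arrows m i j ∸ circle-arrows m j i ≡ circle-arrows m i j
circle-arrows-reduced m i j with toSum (3 ℕ.≤? m)
... | inj₂ 3≰m rewrite dec-false (3 ℕ.≤? m) 3≰m = ≡.refl
... | inj₁ 3≤m rewrite dec-true (3 ℕ.≤? m) 3≤m with toSum (toℕ i ℕ.≟ toℕ (cyc j))
...   | inj₂ i≢ rewrite δ-≢ i≢ = ≡.refl
...   | inj₁ i≡ rewrite Fin.toℕ-injective i≡ | δ-≢ {toℕ j} (λ j≡ →
          cyc²-≢ 3≤m j (≡.sym (Fin.toℕ-injective j≡))) = ℕ.0∸n≡0 (δ (toℕ (cyc j)) (toℕ (cyc j)))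

-- Arrows between adjacent circles

module AnnulusArrows {cc n} (A : Annulus cc n) where
  open Annulus A

  to-circle from-circle : Fin cc → Fin n → ℕ
  to-circle i j   = count (λ t → does (p t Fin.≟ i) ∧ does (x t Fin.≟ j))
  from-circle i j = count (λ t → does (p t Fin.≟ i) ∧ does (x (cyc t) Fin.≟ j))

  increasing-injective : ∀ {m} {f : Fin r → Fin m} → StrictlyIncreasing f →
    ∀ {s t} → f s ≡ f t → s ≡ t
  increasing-injective {f = f} f-inc {s} {t} eq with Fin.<-cmp s t
  ... | tri< s<t _ _ = ⊥-elim (Fin.<-irrefl eq (f-inc s t s<t))
  ... | tri≈ _ s≡t _ = s≡t
  ... | tri> _ _ t<s = ⊥-elim (Fin.<-irrefl (≡.sym eq) (f-inc t s t<s))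

  -- `p` is injective, so only the index `t` contributes. The function `g` will be `x` or its
  -- composite with `cyc`, one for each direction of the arrows.
  count-arrows : ∀ (g : Fin r → Fin n) t j →
    count (λ t′ → does (p t′ Fin.≟ p t) ∧ does (g t′ Fin.≟ j)) ≡ δ (toℕ j) (toℕ (g t))
  count-arrows g t j = ≡.trans
    (count-single (λ t′ → does (p t′ Fin.≟ p t) ∧ does (g t′ Fin.≟ j)) t λ t′ t′≢t →
      cong (_∧ does (g t′ Fin.≟ j))
        (dec-false (p t′ Fin.≟ p t) (t′≢t ∘ increasing-injective p-inc)))
    at-t
    where
    at-t : (if does (p t Fin.≟ p t) ∧ does (g t Fin.≟ j) then 1 else 0) ≡ δ (toℕ j) (toℕ (g t))
    at-t rewrite dec-true (p t Fin.≟ p t) ≡.refl with toSum (g t Fin.≟ j)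
    ... | inj₁ ≡.refl rewrite dec-true (g t Fin.≟ g t) ≡.refl = ≡.sym (δ-refl (toℕ (g t)))
    ... | inj₂ g≢j rewrite dec-false (g t Fin.≟ j) g≢j =
      ≡.sym (δ-≢ (g≢j ∘ ≡.sym ∘ Fin.toℕ-injective))

  -- As `r` is at least 2, the two ends are distinct; nothing cancels, and the plain counts agree
  -- with the truncated differences of a chord.
  x≢x-cyc : ∀ t → toℕ (x t) ≢ toℕ (x (cyc t))
  x≢x-cyc t eq =
    cyc-≢ 2≤r t (≡.sym (increasing-injective x-inc (Fin.toℕ-injective eq)))

  to-circle-p : ∀ t j →
    to-circle (p t) j ≡ δ (toℕ j) (toℕ (x t)) ∸ δ (toℕ j) (toℕ (x (cyc t)))
  to-circle-p t j = ≡.trans (count-arrows x t j) (≡.sym (δ-∸-δ (toℕ j) (x≢x-cyc t)))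

  from-circle-p : ∀ t j →
    from-circle (p t) j ≡ δ (toℕ j) (toℕ (x (cyc t))) ∸ δ (toℕ j) (toℕ (x t))
  from-circle-p t j =
    ≡.trans (count-arrows (x ∘ cyc) t j) (≡.sym (δ-∸-δ (toℕ j) (x≢x-cyc t ∘ ≡.sym)))

  Endpoint : Fin cc → Set
  Endpoint i = ∃ λ t → p t ≡ i

  endpoint? : ∀ i → Dec (Endpoint i)
  endpoint? i = Fin.any? (λ t → p t Fin.≟ i)

  module _ {i} (¬endpoint : ¬ Endpoint i) where
    to-circle-none : ∀ j → to-circle i j ≡ 0
    to-circle-none j = count-none λ t →
      cong (_∧ does (x t Fin.≟ j)) (dec-false (p t Fin.≟ i) λ eq → ¬endpoint (t , eq))

    from-circle-none : ∀ j → from-circle i j ≡ 0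
    from-circle-none j = count-none λ t →
      cong (_∧ does (x (cyc t) Fin.≟ j)) (dec-false (p t Fin.≟ i) λ eq → ¬endpoint (t , eq))


-- The spider web quiver as a cycle with chords

module Spider (a b N : ℕ) (2≤a : 2 ≤ a) (2≤n : 2 ≤ suc (suc N)) (2≤b : 2 ≤ b)
  (outer : Annulus a (suc (suc N))) (inner : Annulus b (suc (suc N))) where

  D : SpiderData
  D = record { a = a ; n = suc (suc N) ; b = b ; 2≤a = 2≤a ; 2≤n = 2≤n ; 2≤b = 2≤b
             ; outer = outer ; inner = inner }

  n M : ℕ
  n = suc (suc N)
  M = suc N

  -- The value at j > M is irrelevant.
  c : ℕ → V D
  c j = mid (j mod n)

  toℕ-mod : ∀ {j} → j ≤ M → toℕ (j mod n) ≡ j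
  toℕ-mod {j} j≤M = ≡.trans (Fin.toℕ-fromℕ< (m%n<n j n)) (m<n⇒m%n≡m (s≤s j≤M))

  ≤M : (i : Fin n) → toℕ i ≤ M
  ≤M i = ℕ.≤-pred (Fin.toℕ<n i)

  c-toℕ : ∀ i → c (toℕ i) ≡ mid i
  c-toℕ i = cong mid (Fin.toℕ-injective (toℕ-mod (≤M i)))

  mid-injective : ∀ {i j} → mid i ≡ (V D ∋ mid j) → i ≡ j
  mid-injective ≡.refl = ≡.refl

  c-injective : ∀ {i j} → i ≤ M → j ≤ M → c i ≡ c j → i ≡ j
  c-injective i≤M j≤M eq =
    ≡.trans (≡.sym (toℕ-mod i≤M)) (≡.trans (cong toℕ (mid-injective eq)) (toℕ-mod j≤M))

  mid≡c : ∀ {i j} → toℕ i ≡ j → mid i ≡ c j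
  mid≡c {i} ≡.refl = ≡.sym (c-toℕ i)

  σ : V D → V D
  σ = swapLast D

  σ-a : ∀ {s} → M ≡ suc s → σ (c s) ≡ c M
  σ-a ≡.refl with toℕ (N mod n) ℕ.≟ N | toℕ (N mod n) ℕ.≟ M
  ... | yes e | _ = mid≡c (≡.trans (toℕ-cyc-< (N mod n) (s≤s (s≤s (ℕ.≤-reflexive e)))) (cong suc e))
  ... | no ne | _ = ⊥-elim (ne (toℕ-mod (ℕ.n≤1+n N)))

  toℕ-pred : ∀ {m} (i : Fin m) → toℕ (Fin.pred i) ≡ ℕ.pred (toℕ i)
  toℕ-pred Fin.zero    = ≡.refl
  toℕ-pred (Fin.suc i) = Fin.toℕ-inject₁ i

  σ-b : ∀ {s} → M ≡ suc s → σ (c M) ≡ c s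
  σ-b ≡.refl with toℕ (M mod n) ℕ.≟ N | toℕ (M mod n) ℕ.≟ M
  ... | yes e | _     = ⊥-elim (ℕ.1+n≢n (≡.trans (≡.sym (toℕ-mod ℕ.≤-refl)) e))
  ... | no _  | yes e = mid≡c (≡.trans (toℕ-pred (M mod n)) (cong ℕ.pred e))
  ... | no _  | no ne = ⊥-elim (ne (toℕ-mod ℕ.≤-refl))

  σ-fix : ∀ {s} → M ≡ suc s → ∀ {v} → v ≢ c s → v ≢ c M → σ v ≡ v
  σ-fix M≡ {out _} _ _ = ≡.refl
  σ-fix M≡ {inn _} _ _ = ≡.refl
  σ-fix ≡.refl {mid i} v≢a v≢b with toℕ i ℕ.≟ N | toℕ i ℕ.≟ M
  ... | yes e | _     = ⊥-elim (v≢a (mid≡c e))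
  ... | no _  | yes e = ⊥-elim (v≢b (mid≡c e))
  ... | no _  | no _  = ≡.refl

  open QuiverMutation (_≟V_ {a} {n} {b})
  open Circle c M c-injective
  open CircleQuiver

  Q : Quiver (V D)
  Q = spiderQuiver D

  module Outer = AnnulusArrows outer
  module Inner = AnnulusArrows inner

  Q-mid : ∀ i j → Q (mid i) (mid j) ≡ circle-arrows n i j
  Q-mid i j with does (3 ℕ.≤? n)
  ... | false = ≡.refl
  ... | true  = ≡.refl

  Q-out : ∀ i j → Q (out i) (out j) ≡ circle-arrows a i j
  Q-out i j with does (3 ℕ.≤? a)
  ... | false = ≡.refl
  ... | true  = ≡.refl

  Q-inn : ∀ i j → Q (inn i) (inn j) ≡ circle-arrows b i j
  Q-inn i j with does (3 ℕ.≤? b)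
  ... | false = ≡.refl
  ... | true  = ≡.refl

  module Attached {cc} (A : Annulus cc n) (vtx : Fin cc → V D)
    (Q-to : ∀ i j → Q (vtx i) (mid j) ≡ AnnulusArrows.to-circle A i j)
    (Q-from : ∀ i j → Q (mid j) (vtx i) ≡ AnnulusArrows.from-circle A i j) where

    open Annulus A
    open AnnulusArrows A

    endpoint-chord : ∀ t → Chord 0 Q (vtx (p t)) (toℕ (x t)) (toℕ (x (cyc t)))
    endpoint-chord t = chord z≤n (≤M (x t)) z≤n (≤M (x (cyc t)))
      (λ {j} _ j≤M → ≡.trans (Q-to (p t) (j mod n)) (≡.trans (to-circle-p t (j mod n))
        (cong (λ i → δ i (toℕ (x t)) ∸ δ i (toℕ (x (cyc t)))) (toℕ-mod j≤M))))
      (λ {j} _ j≤M → ≡.trans (Q-from (p t) (j mod n)) (≡.trans (from-circle-p t (j mod n))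
        (cong (λ i → δ i (toℕ (x (cyc t))) ∸ δ i (toℕ (x t))) (toℕ-mod j≤M))))

    -- Equal ends make an unconnected vertex a case of the general rule, which then gives it the
    -- trivial factor.
    non-endpoint-chord : ∀ {i} → ¬ Endpoint i → Chord 0 Q (vtx i) 0 0
    non-endpoint-chord {i} ¬e = chord z≤n z≤n z≤n z≤n
      (λ {j} _ _ → ≡.trans (Q-to i (j mod n))
        (≡.trans (to-circle-none ¬e (j mod n)) (≡.sym (ℕ.n∸n≡0 (δ j 0)))))
      (λ {j} _ _ → ≡.trans (Q-from i (j mod n))
        (≡.trans (from-circle-none ¬e (j mod n)) (≡.sym (ℕ.n∸n≡0 (δ j 0)))))

    attached-chord : ∀ i → ∃₂ (Chord 0 Q (vtx i))
    attached-chord i with endpoint? i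
    ... | yes (t , ≡.refl) = _ , _ , endpoint-chord t
    ... | no ¬e            = _ , _ , non-endpoint-chord ¬e

  module OuterAttached = Attached outer out (λ _ _ → ≡.refl) (λ _ _ → ≡.refl)
  module InnerAttached = Attached inner inn (λ _ _ → ≡.refl) (λ _ _ → ≡.refl)

  chord-reduced : ∀ {v α β} → Chord 0 Q v α β → ∀ j →
    Q v (mid j) ∸ Q (mid j) v ≡ Q v (mid j) × Q (mid j) v ∸ Q v (mid j) ≡ Q (mid j) v
  chord-reduced {v} {α} {β} C j
    rewrite ≡.sym (c-toℕ j) | Chord.to C z≤n (≤M j) | Chord.from C z≤n (≤M j) =
    ∸-∸-∸ (δ (toℕ j) α) (δ (toℕ j) β) , ∸-∸-∸ (δ (toℕ j) β) (δ (toℕ j) α)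

  spider-reduced : Reduced Q
  spider-reduced (out i) (out j) rewrite Q-out i j | Q-out j i = circle-arrows-reduced a i j
  spider-reduced (inn i) (inn j) rewrite Q-inn i j | Q-inn j i = circle-arrows-reduced b i j
  spider-reduced (mid i) (mid j) rewrite Q-mid i j | Q-mid j i = circle-arrows-reduced n i j
  spider-reduced (out i) (mid j) =
    proj₁ (chord-reduced (proj₂ (proj₂ (OuterAttached.attached-chord i))) j)
  spider-reduced (mid j) (out i) =
    proj₂ (chord-reduced (proj₂ (proj₂ (OuterAttached.attached-chord i))) j)
  spider-reduced (inn i) (mid j) =
    proj₁ (chord-reduced (proj₂ (proj₂ (InnerAttached.attached-chord i))) j)
  spider-reduced (mid j) (inn i) =
    proj₂ (chord-reduced (proj₂ (proj₂ (InnerAttached.attached-chord i))) j)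
  spider-reduced (out _) (inn _) = ≡.refl
  spider-reduced (inn _) (out _) = ≡.refl

  next prev : ℕ → ℕ
  next i = toℕ (cyc (i mod n))
  prev zero    = M
  prev (suc i) = i

  next-< : ∀ {i} → i < M → next i ≡ suc i
  next-< {i} i<M = ≡.trans
    (toℕ-cyc-< (i mod n) (≡.subst (λ j → suc j < n) (≡.sym i≡) (s≤s i<M))) (cong suc i≡)
    where i≡ = toℕ-mod (ℕ.<⇒≤ i<M)

  next-M : next M ≡ 0
  next-M = toℕ-cyc-last (M mod n) (cong suc (toℕ-mod ℕ.≤-refl))

  next-≤ : ∀ i → next i ≤ M
  next-≤ i = ≤M (cyc (i mod n))

  prev-≤ : ∀ {i} → i ≤ M → prev i ≤ M
  prev-≤ {zero}  _   = ℕ.≤-refl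
  prev-≤ {suc i} i<M = ℕ.<⇒≤ i<M

  next-prev : ∀ {i} → i ≤ M → next (prev i) ≡ i
  next-prev {zero}  _   = next-M
  next-prev {suc i} i<M = next-< i<M

  prev-next : ∀ {i} → i ≤ M → prev (next i) ≡ i
  prev-next {i} i≤M with ℕ.m≤n⇒m<n∨m≡n i≤M
  ... | inj₁ i<M    rewrite next-< i<M = ≡.refl
  ... | inj₂ ≡.refl rewrite next-M = ≡.refl

  δ-next-prev : ∀ {i j} → i ≤ M → j ≤ M → δ i (next j) ≡ δ j (prev i)
  δ-next-prev {i} {j} i≤M j≤M with toSum (j ℕ.≟ prev i)
  ... | inj₁ ≡.refl rewrite next-prev i≤M = ≡.trans (δ-refl i) (≡.sym (δ-refl (prev i)))
  ... | inj₂ j≢ rewrite δ-≢ j≢ =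
    δ-≢ {i} {next j} λ i≡ → j≢ (≡.sym (≡.trans (cong prev i≡) (prev-next j≤M)))

  Q-c : ∀ {i j} → i ≤ M → j ≤ M →
    Q (c i) (c j) ≡ (if does (3 ℕ.≤? n) then δ j (next i) else 0)
  Q-c {i} {j} i≤M j≤M rewrite Q-mid (i mod n) (j mod n) | toℕ-mod j≤M = ≡.refl

  next≢prev : 3 ≤ n → ∀ {i} → i ≤ M → next i ≢ prev i
  next≢prev (s≤s (s≤s 1≤N)) {zero} i≤M eq rewrite next-< {0} (s≤s z≤n) =
    ℕ.<⇒≢ 1≤N (ℕ.suc-injective eq)
  next≢prev (s≤s (s≤s 1≤N)) {suc i} i<M eq with ℕ.m≤n⇒m<n∨m≡n i<M
  ... | inj₁ 1+i<M rewrite next-< 1+i<M = ℕ.<⇒≢ (s≤s (ℕ.n≤1+n i)) (≡.sym eq)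
  ... | inj₂ ≡.refl rewrite next-M = ℕ.<⇒≢ 1≤N eq

  next≡prev : ¬ 3 ≤ n → ∀ {i} → i ≤ M → next i ≡ prev i
  next≡prev 3≰n {i} i≤M with N ℕ.≟ 0
  next≡prev 3≰n {i}     i≤M      | no N≢0 = ⊥-elim (3≰n (s≤s (s≤s (ℕ.n≢0⇒n>0 N≢0))))
  next≡prev 3≰n {zero}  i≤M      | yes N≡0 = ≡.trans (next-< (s≤s z≤n)) (cong suc (≡.sym N≡0))
  next≡prev 3≰n {suc i} (s≤s i≤N) | yes N≡0 rewrite ℕ.n≤0⇒n≡0 (≡.subst (i ≤_) N≡0 i≤N) =
    ≡.trans (cong (next ∘ suc) (≡.sym N≡0)) next-M

  -- With two vertices `next` and `prev` agree, so the truncated differences vanish exactly as the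
  -- 2-cycle is removed.
  circle-chord : ∀ {i} → i ≤ M → Chord 0 Q (c i) (next i) (prev i)
  circle-chord {i} i≤M with toSum (3 ℕ.≤? n)
  ... | inj₁ 3≤n = chord z≤n (next-≤ i) z≤n (prev-≤ i≤M)
    (λ {j} _ j≤M → ≡.trans (Q-c′ i≤M j≤M) (≡.sym (δ-∸-δ j (next≢prev 3≤n i≤M))))
    (λ {j} _ j≤M → ≡.trans (Q-c′ j≤M i≤M) (≡.trans (δ-next-prev i≤M j≤M)
      (≡.sym (δ-∸-δ j (next≢prev 3≤n i≤M ∘ ≡.sym)))))
    where
    Q-c′ : ∀ {i j} → i ≤ M → j ≤ M → Q (c i) (c j) ≡ δ j (next i)
    Q-c′ {i} {j} i≤M j≤M = ≡.trans (Q-c i≤M j≤M)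
      (cong (λ t → if t then δ j (next i) else 0) (dec-true (3 ℕ.≤? n) 3≤n))
  ... | inj₂ 3≰n = chord z≤n (next-≤ i) z≤n (prev-≤ i≤M)
    (λ {j} _ j≤M → ≡.trans (Q-c′ i≤M j≤M)
      (≡.sym (ℕ.m≤n⇒m∸n≡0 (ℕ.≤-reflexive (cong (δ j) (next≡prev 3≰n i≤M))))))
    (λ {j} _ j≤M → ≡.trans (Q-c′ j≤M i≤M)
      (≡.sym (ℕ.m≤n⇒m∸n≡0 (ℕ.≤-reflexive (cong (δ j) (≡.sym (next≡prev 3≰n i≤M)))))))
    where
    Q-c′ : ∀ {i j} → i ≤ M → j ≤ M → Q (c i) (c j) ≡ 0
    Q-c′ {i} {j} i≤M j≤M = ≡.trans (Q-c i≤M j≤M)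
      (cong (λ t → if t then δ j (next i) else 0) (dec-false (3 ℕ.≤? n) 3≰n))

  spider-circle : CircleQuiver 0 Q
  spider-circle = record
    { reduced = spider-reduced
    ; first   = ≡.subst (λ α → Chord 0 Q (c 0) α M) (next-< (s≤s z≤n)) (circle-chord z≤n)
    ; middle  = λ {i} _ 1+i<M → ≡.subst (λ α → Chord 0 Q (c (suc i)) α i)
                  (next-< 1+i<M) (circle-chord (ℕ.<⇒≤ 1+i<M))
    ; last    = ≡.subst (λ α → Chord 0 Q (c M) α N) next-M (circle-chord ℕ.≤-refl)
    ; outside = outside′
    }
    where
    outside′ : ∀ {v} → Outside 0 v → ∃₂ (Chord 0 Q v)
    outside′ {out i} _  = OuterAttached.attached-chord i
    outside′ {inn i} _  = InnerAttached.attached-chord i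
    outside′ {mid i} v∉ = ⊥-elim (v∉ z≤n (≤M i) (≡.sym (c-toℕ i)))

  module _ {k ℓ} (F : Semifield k ℓ) where

    open Spin F (_≟V_ {a} {n} {b}) c M c-injective σ σ-a σ-b σ-fix using (spin)

    mutateList-++ : ∀ xs ys S →
      mutateList F D (xs ++ ys) S ≡ mutateList F D ys (mutateList F D xs S)
    mutateList-++ []       ys S = ≡.refl
    mutateList-++ (x ∷ xs) ys S = mutateList-++ xs ys (mutate F _≟V_ x S)

    -- The mutation at `c s` heads the ascending list and ends the descending one. The latter is two
    -- entries shorter, since the last two vertices are mutated only once.
    mutateList-spin : ∀ s d S →
      mutateList F D (List.map c (List.reverse (List.iterate suc s d)))
        (relabel F σ (mutateList F D (List.map c (List.iterate suc s (suc (suc d)))) S))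
      ≡ spin s d S
    mutateList-spin s zero    S = ≡.refl
    mutateList-spin s (suc d) S = ≡.trans
      (cong (λ ks → mutateList F D ks S₁) (≡.trans
        (cong (List.map c) (List.unfold-reverse s (List.iterate suc (suc s) d)))
        (List.map-++ c (List.reverse (List.iterate suc (suc s) d)) (s ∷ []))))
      (≡.trans (mutateList-++ (List.map c (List.reverse (List.iterate suc (suc s) d))) _ S₁)
        (cong (mutate F _≟V_ (c s)) (mutateList-spin (suc s) d (mutate F _≟V_ (c s) S))))
      where
      S₁ = relabel F σ (mutateList F D (List.map c (List.iterate suc s (suc (suc (suc d))))) S)

    tau≡spin : ∀ S → tau F D S ≡ spin 0 N S
    tau≡spin S = ≡.trans
      (cong₂ (λ ks ks′ → mutateList F D ks (relabel F σ (mutateList F D ks′ S))) descending ascending)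
      (mutateList-spin 0 N S)
      where
      below : List (Fin n)
      below = List.filter (λ i → toℕ i ℕ.<? N) (List.allFin n)

      ascending : List.map mid (List.allFin n) ≡ List.map c (List.iterate suc 0 n)
      ascending = ≡.trans (List.map-tabulate id mid)
        (map-tabulate-iterate mid c 0 (λ i → ≡.sym (c-toℕ i)))

      below≡ : List.map toℕ below ≡ List.iterate suc 0 N
      below≡ = ≡.trans
        (cong (λ m → List.map toℕ (List.filter (λ i → toℕ i ℕ.<? m) (List.allFin n)))
          (≡.sym (ℕ.+-identityʳ N)))
        (filter-tabulate id 0 N (λ _ → ≡.refl) (ℕ.m≤n+m N 2))

      descending : List.map mid (List.reverse below) ≡
        List.map c (List.reverse (List.iterate suc 0 N))
      descending = ≡.trans (List.map-cong (λ i → ≡.sym (c-toℕ i)) (List.reverse below))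
        (≡.trans (List.map-∘ (List.reverse below))
          (cong (List.map c) (≡.trans (List.reverse-map toℕ below) (cong List.reverse below≡))))

-- The explicit formulas

module CyclicSums {r ℓ} (R : CommutativeSemiring r ℓ) where

  open CommutativeSemiring R
  open import Relation.Binary.Reasoning.Setoid setoid
  open import Algebra.Solver.Ring.NaturalCoefficients.Default R
  open WindowSums R

  prodFrom-shift : ∀ f l k → prodFrom f (suc l) k ≡ prodFrom (λ j → f (suc j)) l k
  prodFrom-shift f l zero    = ≡.refl
  prodFrom-shift f l (suc k) = cong (f (suc l) *_) (prodFrom-shift f (suc l) k)

  sumFrom-shift : ∀ f l k → sumFrom f (suc l) k ≡ sumFrom (λ j → f (suc j)) l k
  sumFrom-shift f l zero    = ≡.refl
  sumFrom-shift f l (suc k) = cong (f (suc l) +_) (sumFrom-shift f (suc l) k)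

  -- Numerator and denominator are windows divided by the monomials `p` and `p′`. These differ by
  -- exactly `zᵢ`, so the formula has no prefactor.
  ratio-on-circle : ∀ {y′ zᵢ num den p p′ w₀ w₂} → y′ * w₂ ≈ zᵢ * w₀ →
    p * num ≈ w₀ → p′ * den ≈ w₂ → p′ ≈ p * zᵢ → p′ * (y′ * den) ≈ p′ * num
  ratio-on-circle {y′} {zᵢ} {num} {den} {p} {p′} {w₀} {w₂} e num-eq den-eq p′≈ = begin
    p′ * (y′ * den)   ≈⟨ solve 3 (λ a b d → a :* (b :* d) := b :* (a :* d)) refl _ _ _ ⟩
    y′ * (p′ * den)   ≈⟨ *-congˡ den-eq ⟩
    y′ * w₂           ≈⟨ e ⟩
    zᵢ * w₀           ≈⟨ *-congˡ (sym num-eq) ⟩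
    zᵢ * (p * num)    ≈⟨ solve 3 (λ a b d → a :* (b :* d) := b :* a :* d) refl _ _ _ ⟩
    p * zᵢ * num      ≈⟨ *-congʳ (sym p′≈) ⟩
    p′ * num          ∎

  -- Both windows are divided by the same monomial here, so the prefactor `yᵥ` remains.
  ratio-off-circle : ∀ {y′ yᵥ num den p w₀ t} → w₀ * y′ ≈ yᵥ * t →
    p * num ≈ t → p * den ≈ w₀ → p * (y′ * den) ≈ p * (yᵥ * num)
  ratio-off-circle {y′} {yᵥ} {num} {den} {p} {w₀} {t} e num-eq den-eq = begin
    p * (y′ * den)    ≈⟨ solve 3 (λ a b d → a :* (b :* d) := a :* d :* b) refl _ _ _ ⟩
    p * den * y′      ≈⟨ *-congʳ den-eq ⟩
    w₀ * y′           ≈⟨ e ⟩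
    yᵥ * t            ≈⟨ *-congˡ (sym num-eq) ⟩
    yᵥ * (p * num)    ≈⟨ solve 3 (λ a b d → a :* (b :* d) := b :* (a :* d)) refl _ _ _ ⟩
    p * (yᵥ * num)    ∎

  module PaperSums (M : ℕ) (z Y : ℕ → Carrier)
    (Y-zero : Y 0 ≡ 1#) (Y-suc : ∀ {k} → k ≤ M → Y (suc k) ≈ z k)
    (S Π : ℕ → ℕ → (ℕ → Carrier) → Carrier)
    (S≡∑ : ∀ lo hi f → S lo hi f ≡ ∑ f lo hi)
    (Π≡∏ : ∀ lo hi f → Π lo hi f ≡ ∏ f lo hi)
    where

    n : ℕ
    n = suc M

    P : ℕ → ℕ → Carrier
    P lo hi = Π lo hi Y

    w : ℕ → Carrier
    w = W 0 M z

    P-suc : ∀ lo {hi} → hi ≤ n → P (suc lo) (suc hi) ≈ ∏ z lo hi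
    P-suc lo {hi} hi≤n = begin
      Π (suc lo) (suc hi) Y         ≡⟨ Π≡∏ (suc lo) (suc hi) Y ⟩
      ∏ Y (suc lo) (suc hi)         ≡⟨ prodFrom-shift Y lo (hi ∸ lo) ⟩
      ∏ (λ j → Y (suc j)) lo hi     ≈⟨ ∏-cong {lo = lo} {hi} (λ j _ j<hi →
                                         Y-suc (ℕ.≤-pred (ℕ.≤-trans j<hi hi≤n))) ⟩
      ∏ z lo hi                     ∎

    P-zero : ∀ {hi} → hi ≤ n → P 0 (suc hi) ≈ ∏ z 0 hi
    P-zero {hi} hi≤n = begin
      Π 0 (suc hi) Y       ≡⟨ Π≡∏ 0 (suc hi) Y ⟩
      Y 0 * ∏ Y 1 (suc hi) ≡⟨ cong₂ _*_ Y-zero (≡.sym (Π≡∏ 1 (suc hi) Y)) ⟩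
      1# * P 1 (suc hi)    ≈⟨ *-identityˡ _ ⟩
      P 1 (suc hi)         ≈⟨ P-suc 0 hi≤n ⟩
      ∏ z 0 hi             ∎

    S-cong : ∀ {f g lo hi} → (∀ j → lo ≤ j → j < hi → f j ≈ g j) → S lo hi f ≈ ∑ g lo hi
    S-cong {f} {g} {lo} {hi} f≈g =
      trans (reflexive (S≡∑ lo hi f)) (∑-cong {lo = lo} {hi} f≈g)

    S-P-suc : ∀ t i → S i n (λ j → P (suc t) (suc j)) ≈ ∑ (∏ z t) i n
    S-P-suc t i = S-cong {lo = i} λ j _ j<n → P-suc t (ℕ.<⇒≤ j<n)

    S-P-shift : ∀ t → S (suc t) (suc n) (λ j → P (suc t) j) ≈ ∑ (∏ z t) t n
    S-P-shift t = begin
      S (suc t) (suc n) (P (suc t))           ≡⟨ S≡∑ (suc t) (suc n) (P (suc t)) ⟩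
      ∑ (P (suc t)) (suc t) (suc n)           ≡⟨ sumFrom-shift (P (suc t)) t (n ∸ t) ⟩
      ∑ (λ j → P (suc t) (suc j)) t n         ≈⟨ ∑-cong {lo = t} (λ j _ j<n → P-suc t (ℕ.<⇒≤ j<n)) ⟩
      ∑ (∏ z t) t n                           ∎

    S-P-zero : ∀ {lo hi} → hi ≤ n → S lo hi (λ j → P 0 (suc j)) ≈ ∑ (∏ z 0) lo hi
    S-P-zero {lo} hi≤n = S-cong {lo = lo} λ j _ j<hi → P-zero (ℕ.<⇒≤ (ℕ.≤-trans j<hi hi≤n))

    -- The window sum starting at i, divided by z 0 ⋯ z (t ∸ 1).
    W-from : ℕ → ℕ → Carrier
    W-from t i = ∑ (∏ z t) i n + ∏ z t n * ∑ (∏ z 0) 0 i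

    *-W-from : ∀ {t i} → t ≤ i → i ≤ n → ∏ z 0 t * W-from t i ≈ w i
    *-W-from {t} {i} t≤i i≤n = begin
      ∏ z 0 t * (∑ (∏ z t) i n + ∏ z t n * ∑ (∏ z 0) 0 i)
        ≈⟨ solve 4 (λ a b d e → a :* (b :+ d :* e) := a :* b :+ a :* d :* e) refl _ _ _ _ ⟩
      ∏ z 0 t * ∑ (∏ z t) i n + ∏ z 0 t * ∏ z t n * ∑ (∏ z 0) 0 i
        ≈⟨ +-cong (*-distrib-∑ (∏ z 0 t) (∏ z t) i n)
                  (*-congʳ (sym (∏-split z z≤n (ℕ.≤-trans t≤i i≤n)))) ⟩
      ∑ (λ j → ∏ z 0 t * ∏ z t j) i n + ∏ z 0 n * ∑ (∏ z 0) 0 i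
        ≈⟨ +-congʳ (∑-cong {lo = i} λ j i≤j _ → sym (∏-split z z≤n (ℕ.≤-trans t≤i i≤j))) ⟩
      w i ∎

    *-paper-sum : ∀ {t i} → t ≤ i → i ≤ n →
      ∏ z 0 t * (S i n (λ j → P (suc t) (suc j)) + P (suc t) (suc n) * S 0 i (λ j → P 0 (suc j)))
      ≈ w i
    *-paper-sum {t} {i} t≤i i≤n = trans
      (*-congˡ (+-cong (S-P-suc t i) (*-cong (P-suc t ℕ.≤-refl) (S-P-zero {0} i≤n))))
      (*-W-from t≤i i≤n)

    -- The products stop one short of their index, and the range is shifted by one to match, so the
    -- same window results.
    *-paper-sum-shift : ∀ {t} → t ≤ n →
      ∏ z 0 t * (S (suc t) (suc n) (λ j → P (suc t) j) + P (suc t) (suc n) * S 0 t (λ j → P 0 (suc j)))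
      ≈ w t
    *-paper-sum-shift {t} t≤n = trans
      (*-congˡ (+-cong (S-P-shift t) (*-cong (P-suc t ℕ.≤-refl) (S-P-zero {0} t≤n))))
      (*-W-from ℕ.≤-refl t≤n)

    paper-sum-zero : ∀ {i} → i ≤ n →
      S i n (λ j → P 0 (suc j)) + P 0 (suc n) * S 0 i (λ j → P 0 (suc j)) ≈ w i
    paper-sum-zero {i} i≤n =
      +-cong (S-P-zero {i} ℕ.≤-refl) (*-cong (P-zero ℕ.≤-refl) (S-P-zero {0} i≤n))

    -- The leading `1#` is the part of the window at `M` before it wraps around, which has a single
    -- term.
    paper-num2 : ∏ z 0 M * (1# + Y n * S 0 M (λ j → P 0 (suc j))) ≈ w M
    paper-num2 = trans (*-congˡ (+-cong
        (begin
          1#                              ≈⟨ sym (+-identityʳ 1#) ⟩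
          1# + 0#                         ≡⟨ cong₂ _+_ (∏-empty z M) (∑-empty (∏ z M) n) ⟨
          ∏ z M M + ∑ (∏ z M) n n         ≡⟨ ∑-head (∏ z M) ℕ.≤-refl ⟨
          ∑ (∏ z M) M n                   ∎)
        (*-cong (trans (Y-suc ℕ.≤-refl) (sym (∏-singleton z M))) (S-P-zero {0} (ℕ.n≤1+n M)))))
      (*-W-from ℕ.≤-refl (ℕ.n≤1+n M))

    -- The separate product is the wrapped part of the window at 1: p n times its only term p 0 = 1.
    paper-den2 : S 1 n (λ j → P 1 (suc j)) + P 1 (suc n) ≈ w 1
    paper-den2 = +-cong (S-P-suc 0 1) (begin
      P 1 (suc n)               ≈⟨ P-suc 0 ℕ.≤-refl ⟩
      ∏ z 0 n                   ≈⟨ solve 1 (λ a → a := a :* (con 1 :+ con 0)) refl _ ⟩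
      ∏ z 0 n * ∑ (∏ z 0) 0 1   ∎)

    -- The product after `e` completes the monomial up to `e` to p n, the wrap-around factor of
    -- `target`.
    *-paper-numMax : ∀ {e d} → e ≤ n → d ≤ n →
      ∏ z 0 e * (P (suc e) (suc n) *
        (S d n (λ j → P 0 (suc j)) + P 0 (suc n) * S 0 d (λ j → P 0 (suc j)))) ≈ ∏ z 0 n * w d
    *-paper-numMax {e} {d} e≤n d≤n = begin
      ∏ z 0 e * (P (suc e) (suc n) * _)  ≈⟨ *-congˡ (*-cong (P-suc e ℕ.≤-refl) (paper-sum-zero d≤n)) ⟩
      ∏ z 0 e * (∏ z e n * w d)          ≈⟨ sym (*-assoc _ _ _) ⟩
      ∏ z 0 e * ∏ z e n * w d            ≈⟨ *-congʳ (sym (∏-split z z≤n e≤n)) ⟩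
      ∏ z 0 n * w d                      ∎

module ExprSums {c ℓ} (F : Semifield c ℓ) where
  open Semifield F using (_⁻¹)
  open Expr F
  open WithZero F
  open WindowSums S₀-commutativeSemiring

  -- The local recursion of the sum is reached only through its ends, so its tail of length `k` is
  -- presented as the range from `suc l` to `suc l + k`.
  Σ≡sumFrom : ∀ f l h k → h ∸ l ≡ k → Σ[ l , h ⟩ f ≡ sumFrom f l k
  Σ≡sumFrom f l h zero    eq rewrite eq = ≡.refl
  Σ≡sumFrom f l h (suc k) eq rewrite eq
    with l ℕ.+ k ∸ l | ℕ.m+n∸m≡n l k | Σ≡sumFrom f (suc l) (suc l ℕ.+ k) k
  ... | _ | ≡.refl | ih = cong (f l +₀_) (ih ≡.refl)

  Π≡prodFrom : ∀ f l h k → h ∸ l ≡ k → Π[ l , h ⟩ f ≡ prodFrom f l k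
  Π≡prodFrom f l h zero    eq rewrite eq = ≡.refl
  Π≡prodFrom f l h (suc k) eq rewrite eq
    with l ℕ.+ k ∸ l | ℕ.m+n∸m≡n l k | Π≡prodFrom f (suc l) (suc l ℕ.+ k) k
  ... | _ | ≡.refl | ih = cong (f l *₀_) (ih ≡.refl)

  Σ≡∑ : ∀ lo hi f → Σ[ lo , hi ⟩ f ≡ ∑ f lo hi
  Σ≡∑ lo hi f = Σ≡sumFrom f lo hi (hi ∸ lo) ≡.refl

  Π≡∏ : ∀ lo hi f → Π[ lo , hi ⟩ f ≡ ∏ f lo hi
  Π≡∏ lo hi f = Π≡prodFrom f lo hi (hi ∸ lo) ≡.refl

  NonZero₀-resp-≈ : ∀ {a b} → a ≈₀ b → NonZero₀ a → NonZero₀ b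
  NonZero₀-resp-≈ {just _} {just _} _ _ = _ , ≡.refl

  NonZero₀-*⁻ʳ : ∀ {a b} → NonZero₀ (a *₀ b) → NonZero₀ b
  NonZero₀-*⁻ʳ {just _} {just _} _ = _ , ≡.refl

  *₀-÷₀-assoc : ∀ u a b → NonZero₀ b → (u *₀ a) ÷₀ b ≈₀ u *₀ (a ÷₀ b)
  *₀-÷₀-assoc (just u) (just a) (just b) _ = *₀-assoc (just u) (just a) (just (b ⁻¹))
  *₀-÷₀-assoc (just u) nothing  (just b) _ = ≈₀-refl {nothing}
  *₀-÷₀-assoc nothing  (just a) (just b) _ = ≈₀-refl {nothing}
  *₀-÷₀-assoc nothing  nothing  (just b) _ = ≈₀-refl {nothing}

  *₀-÷₀-unique : ∀ x u a b → NonZero₀ b → x *₀ b ≈₀ u *₀ a → x ≈₀ u *₀ (a ÷₀ b)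
  *₀-÷₀-unique x u a b b≠0 e = ≈₀-trans {x} {(u *₀ a) ÷₀ b} {u *₀ (a ÷₀ b)}
    (÷₀-unique x (u *₀ a) b b≠0 e) (*₀-÷₀-assoc u a b b≠0)

-- Matching the windows with the formulas

module Claims {k ℓ : Level} (F : Semifield k ℓ)
  (a b N : ℕ) (2≤a : 2 ≤ a) (2≤n : 2 ≤ suc (suc N)) (2≤b : 2 ≤ b)
  (outer : Annulus a (suc (suc N))) (inner : Annulus b (suc (suc N)))
  (y : Vtx a (suc (suc N)) b → Semifield.Carrier F) where

  open Spider a b N 2≤a 2≤n 2≤b outer inner
  open Formulas F D y hiding (Q)
  open Semifield F using (Carrier; _≈_; 1#)
  open ExprSums F
  open Spin F (_≟V_ {a} {n} {b}) c M c-injective σ σ-a σ-b σ-fix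

  z : ℕ → S₀
  z = just ∘ y ∘ c

  Y-suc : ∀ {j} → j ≤ M → Y (suc j) ≈₀ z j
  Y-suc {j} j≤M with j ℕ.<? n
  ... | no ¬j<n = ⊥-elim (¬j<n (s≤s j≤M))
  ... | yes j<n = ≡.subst (λ v → just (y v) ≈₀ z j)
    (≡.sym (mid≡c {Fin.fromℕ< j<n} (Fin.toℕ-fromℕ< j<n))) (≈₀-refl {z j})

  open CyclicSums S₀-commutativeSemiring using (ratio-on-circle; ratio-off-circle)
  open CyclicSums.PaperSums S₀-commutativeSemiring M z Y ≡.refl (λ {j} → Y-suc {j})
    (λ lo hi f → Σ[ lo , hi ⟩ f) (λ lo hi f → Π[ lo , hi ⟩ f) Σ≡∑ Π≡∏
    using (w; *-paper-sum; *-paper-sum-shift; paper-num2; paper-den2;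
           *-paper-numMax)

  ∏z-NonZero : ∀ lo hi → NonZero₀ (∏ z lo hi)
  ∏z-NonZero lo hi = ∏-Pos lo hi (λ _ → _ , ≡.refl)

  -- The term p i is nonzero whenever the first sum is not empty; at the right end the wrapped part
  -- has to supply the nonzero term.
  w-NonZero : ∀ {i} → i ≤ suc M → NonZero₀ (w i)
  w-NonZero {i} i≤n with ℕ.m≤n⇒m<n∨m≡n i≤n
  ... | inj₁ i<n    = NonZero₀-+ _ (≡.subst NonZero₀ (≡.sym (∑-head (∏ z 0) i<n))
                        (NonZero₀-+ _ (∏z-NonZero 0 i)))
  ... | inj₂ ≡.refl = NonZero₀-resp-≈ (≈₀-sym {w n} (W-last 0 M z))
                        (NonZero₀-* (∏z-NonZero 0 n) (W-start-Pos 0 z z≤n))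

  evolved : Evolved 0 Q (just ∘ y) (just ∘ y′)
  evolved = ≡.subst (λ T → Evolved 0 Q (just ∘ y) (just ∘ proj₂ T)) (≡.sym (tau≡spin F (Q , y)))
    (proj₂ (spin-evolved 0 N (Q , y) (≡.sym (ℕ.+-comm N 1)) spider-circle))

  open Evolved evolved

  -- A denominator is nonzero because a multiple of it is a window sum.
  den-NonZero : ∀ {p den i} → i ≤ suc M → p *₀ den ≈₀ w i → NonZero₀ den
  den-NonZero {p} {den} {i} i≤n e =
    NonZero₀-*⁻ʳ {p} (NonZero₀-resp-≈ (≈₀-sym {p *₀ den} e) (w-NonZero i≤n))

  claim1 : ∀ (i : Fin n) → lab i ≤ n ∸ 1 → just (y′ (mid i)) ≈₀ num1 (lab i) ÷₀ den1 (lab i)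
  claim1 i i<M = ÷₀-unique (just (y′ (mid i))) num den (den-NonZero {p′} {den} 2+i≤n den-eq)
    (*₀-cancel {a = just (y′ (mid i)) *₀ den} {num} (∏z-NonZero 0 (suc i₀))
      (ratio-on-circle {just (y′ (mid i))} {z i₀} {num} {den} {p} {p′} {w i₀} {w (suc (suc i₀))}
        (≡.subst (λ v → just (y′ v) *₀ w (suc (suc i₀)) ≈₀ z i₀ *₀ w i₀) (c-toℕ i)
          (on-circle z≤n i<M))
        num-eq den-eq (∏-last z {0} {i₀} z≤n)))
    where
    i₀ = toℕ i
    num = num1 (suc i₀)
    den = den1 (suc i₀)
    p = ∏ z 0 i₀
    p′ = ∏ z 0 (suc i₀)
    2+i≤n = s≤s i<M
    den-eq : p′ *₀ den ≈₀ w (suc (suc i₀))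
    den-eq = *-paper-sum (ℕ.n≤1+n _) 2+i≤n
    num-eq : p *₀ num ≈₀ w i₀
    num-eq = *-paper-sum-shift (ℕ.<⇒≤ (ℕ.<⇒≤ 2+i≤n))

  claim2 : ∀ (i : Fin n) → lab i ≡ n → just (y′ (mid i)) ≈₀ num2 ÷₀ den2
  claim2 i i≡M = ÷₀-unique (just (y′ (mid i))) num2 den2 den≠0
    (*₀-cancel {a = just (y′ (mid i)) *₀ den2} {num2} (∏z-NonZero 0 n)
      -- The factor p n in `at-last` is exactly the monomial `p′` of the ratio, so `den2` is the
      -- window at 1 itself.
      (ratio-on-circle {just (y′ (mid i))} {z M} {num2} {den2} {∏ z 0 M} {∏ z 0 n} {w M}
        {∏ z 0 n *₀ w 1}
        (≡.subst (λ v → just (y′ v) *₀ (∏ z 0 n *₀ w 1) ≈₀ z M *₀ w M) (≡.sym (mid≡c (ℕ.suc-injective i≡M)))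
          at-last)
        paper-num2 (*₀-cong {∏ z 0 n} (≈₀-refl {∏ z 0 n}) paper-den2) (∏-last z {0} {M} z≤n)))
    where
    den≠0 : NonZero₀ den2
    den≠0 = NonZero₀-resp-≈ (≈₀-sym {den2} paper-den2) (w-NonZero (s≤s z≤n))

  module CircleClaim {cc} (A : Annulus cc n) (vtx : Fin cc → V D)
    (Q-to : ∀ i j → Q (vtx i) (mid j) ≡ AnnulusArrows.to-circle A i j)
    (Q-from : ∀ i j → Q (mid j) (vtx i) ≡ AnnulusArrows.from-circle A i j)
    (vtx-outside : ∀ i → Outside 0 (vtx i)) where

    open Annulus A
    open AnnulusArrows A
    open Attached A vtx Q-to Q-from

    Q-to-p : ∀ t j → Q (vtx (p t)) (mid j) ≡ δ (toℕ j) (toℕ (x t))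
    Q-to-p t j = ≡.trans (Q-to (p t) j) (count-arrows x t j)

    Q-from-p : ∀ t j → Q (mid j) (vtx (p t)) ≡ δ (toℕ j) (toℕ (x (cyc t)))
    Q-from-p t j = ≡.trans (Q-from (p t) j) (count-arrows (x ∘ cyc) t j)

    Conn-x : ∀ t → Conn (vtx (p t)) (x t)
    Conn-x t rewrite Q-to-p t (x t) | δ-refl (toℕ (x t)) = s≤s z≤n

    Conn-x-cyc : ∀ t → Conn (vtx (p t)) (x (cyc t))
    Conn-x-cyc t rewrite Q-from-p t (x (cyc t)) | δ-refl (toℕ (x (cyc t))) =
      ℕ.m≤n+m 1 _

    Conn-ends : ∀ t j → Conn (vtx (p t)) j → j ≡ x t ⊎ j ≡ x (cyc t)
    Conn-ends t j conn with j Fin.≟ x t | j Fin.≟ x (cyc t)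
    ... | yes e | _     = inj₁ e
    ... | no _  | yes e = inj₂ e
    ... | no ne | no ne′ rewrite Q-to-p t j | Q-from-p t j
      | δ-≢ (ne ∘ Fin.toℕ-injective) | δ-≢ (ne′ ∘ Fin.toℕ-injective) = ⊥-elim (ℕ.n≮n 0 conn)

    Conn⇒Endpoint : ∀ i {j} → Conn (vtx i) j → Endpoint i
    Conn⇒Endpoint i {j} conn with endpoint? i
    ... | yes e = e
    ... | no ¬e rewrite Q-to i j | Q-from i j | to-circle-none ¬e j | from-circle-none ¬e j =
      ⊥-elim (ℕ.n≮n 0 conn)

    increasing-reflects-< : ∀ {m} {f : Fin r → Fin m} → StrictlyIncreasing f →
      ∀ {s t} → f s Fin.< f t → s Fin.< t
    increasing-reflects-< {f = f} f-inc {s} {t} fs<ft with Fin.<-cmp s t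
    ... | tri< s<t _ _ = s<t
    ... | tri≈ _ s≡t _ = ⊥-elim (Fin.<-irrefl (cong f s≡t) fs<ft)
    ... | tri> _ _ t<s = ⊥-elim (ℕ.<-asym fs<ft (f-inc t s t<s))

    t<cyc : ∀ {t} → suc (toℕ t) < r → t Fin.< cyc t
    t<cyc {t} 1+t<r = ℕ.≤-reflexive (≡.sym (toℕ-cyc-< t 1+t<r))

    x<x-cyc : ∀ {t} → suc (toℕ t) < r → x t Fin.< x (cyc t)
    x<x-cyc {t} 1+t<r = x-inc t (cyc t) (t<cyc 1+t<r)

    x-cyc<x : ∀ {t} → suc (toℕ t) ≡ r → x (cyc t) Fin.< x t
    x-cyc<x {t} 1+t≡r = x-inc (cyc t) t (≡.subst (_< toℕ t) (≡.sym (toℕ-cyc-last t 1+t≡r))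
      (ℕ.≤-pred (≡.subst (2 ≤_) (≡.sym 1+t≡r) 2≤r)))

    min-unique : ∀ {v d α} → IsMinConn v d → Conn v α → (∀ j → Conn v j → α Fin.≤ j) → d ≡ α
    min-unique {α = α} (conn , min) conn-α min-α =
      Fin.≤-antisym (min α conn-α) (min-α _ conn)

    max-unique : ∀ {v e β} → IsMaxConn v e → Conn v β → (∀ j → Conn v j → j Fin.≤ β) → e ≡ β
    max-unique {β = β} (conn , max) conn-β max-β =
      Fin.≤-antisym (max-β _ conn) (max β conn-β)

    -- Before the last index `cyc` does not wrap around, so the end `α` of the chord comes first.
    min-≡x : ∀ {t d} → suc (toℕ t) < r → IsMinConn (vtx (p t)) d → d ≡ x t
    min-≡x {t} 1+t<r isMin = min-unique {vtx (p t)} isMin (Conn-x t) x-min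
      where
      x-min : ∀ j → Conn (vtx (p t)) j → x t Fin.≤ j
      x-min j conn with Conn-ends t j conn
      ... | inj₁ ≡.refl = ℕ.≤-refl
      ... | inj₂ ≡.refl = ℕ.<⇒≤ (x<x-cyc 1+t<r)

    max-≡x-cyc : ∀ {t e} → suc (toℕ t) < r → IsMaxConn (vtx (p t)) e → e ≡ x (cyc t)
    max-≡x-cyc {t} 1+t<r isMax = max-unique {vtx (p t)} isMax (Conn-x-cyc t) x-max
      where
      x-max : ∀ j → Conn (vtx (p t)) j → j Fin.≤ x (cyc t)
      x-max j conn with Conn-ends t j conn
      ... | inj₁ ≡.refl = ℕ.<⇒≤ (x<x-cyc 1+t<r)
      ... | inj₂ ≡.refl = ℕ.≤-refl

    -- At the last index `cyc` wraps around to 0 and the two ends appear in the opposite order.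
    max-≡x : ∀ {t e} → suc (toℕ t) ≡ r → IsMaxConn (vtx (p t)) e → e ≡ x t
    max-≡x {t} 1+t≡r isMax = max-unique {vtx (p t)} isMax (Conn-x t) x-max
      where
      x-max : ∀ j → Conn (vtx (p t)) j → j Fin.≤ x t
      x-max j conn with Conn-ends t j conn
      ... | inj₁ ≡.refl = ℕ.≤-refl
      ... | inj₂ ≡.refl = ℕ.<⇒≤ (x-cyc<x 1+t≡r)

    off : ∀ t → w (suc (toℕ (x t))) *₀ just (y′ (vtx (p t))) ≈₀
      just (y (vtx (p t))) *₀ target 0 z (toℕ (x t)) (toℕ (x (cyc t)))
    off t = off-circle (vtx-outside (p t)) (endpoint-chord t)

    claim-unconnected : ∀ i → (∀ j → ¬ Conn (vtx i) j) → y′ (vtx i) ≈ y (vtx i)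
    claim-unconnected i ¬conn =
      *₀-cancel {a = just (y′ (vtx i))} {b = just (y (vtx i))} (w-NonZero (s≤s z≤n)) (≈₀-trans {w 1 *₀ just (y′ (vtx i))}
        (off-circle (vtx-outside i) (non-endpoint-chord λ { (t , ≡.refl) → ¬conn _ (Conn-x t) }))
        (*₀-comm (just (y (vtx i))) (w 1)))

    -- The chord of the last connected vertex runs backwards, from α = x t to β = x 0, so this is
    -- the case of `target` with the factor p n.
    claim-last : ∀ i d e → IsMinConn (vtx i) d → IsMaxConn (vtx i) e →
      (∀ i′ → i Fin.< i′ → ∀ j → ¬ Conn (vtx i′) j) →
      ∀ first d₁ → toℕ first ≡ 0 → IsMinConn (vtx first) d₁ →
      just (y′ (vtx i)) ≈₀ just (y (vtx i)) *₀ (numMax (lab e) (lab d₁) ÷₀ denMax (lab e) (lab d₁))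
    claim-last i d e isMin isMax i-last first d₁ first≡0 isMin₁
      with Conn⇒Endpoint i (proj₁ isMin)
    ... | t , ≡.refl with <-or-last t
    ...   | inj₁ 1+t<r =
            ⊥-elim (i-last (p (cyc t)) (p-inc t (cyc t) (t<cyc 1+t<r)) _ (Conn-x (cyc t)))
    -- `cyc t` has index 0, so `p-fst` identifies `first` with `p (cyc t)`; its minimal connection
    -- `d₁` is then the end `β`.
    ...   | inj₂ 1+t≡r with Fin.toℕ-injective {i = first} {p (cyc t)}
                              (≡.trans first≡0 (≡.sym (p-fst (cyc t) (toℕ-cyc-last t 1+t≡r))))
    ...     | ≡.refl with max-≡x 1+t≡r isMax | min-≡x {cyc t} 1+t₀<r isMin₁
              where
              1+t₀<r : suc (toℕ (cyc t)) < r
              1+t₀<r rewrite toℕ-cyc-last t 1+t≡r = 2≤r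
    ...       | ≡.refl | ≡.refl =
      *₀-÷₀-unique (just (y′ v)) (just (y v)) num den (den-NonZero {∏ z 0 e′} {den} e′≤n den-eq)
        (*₀-cancel {a = just (y′ v) *₀ den} {just (y v) *₀ num} (∏z-NonZero 0 e′)
          (ratio-off-circle {just (y′ v)} {just (y v)} {num} {den} {∏ z 0 e′}
            {w e′} {∏ z 0 n *₀ w d′}
            (≡.subst (λ T → w e′ *₀ just (y′ v) ≈₀ just (y v) *₀ T)
              (target-> 0 z (x-cyc<x 1+t≡r)) (off t))
            (*-paper-numMax e′≤n (s≤s (≤M (x (cyc t))))) den-eq))
      where
      v = vtx (p t)
      e′ = lab (x t)
      d′ = lab (x (cyc t))
      num = numMax e′ d′
      den = denMax e′ d′
      e′≤n : e′ ≤ n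
      e′≤n = s≤s (≤M (x t))
      den-eq : ∏ z 0 e′ *₀ den ≈₀ w e′
      den-eq = *-paper-sum-shift e′≤n

    claim-other : ∀ i d e → IsMinConn (vtx i) d → IsMaxConn (vtx i) e →
      Σ (Fin cc) (λ i′ → i Fin.< i′ × Σ (Fin n) (λ j → Conn (vtx i′) j)) →
      just (y′ (vtx i)) ≈₀ just (y (vtx i)) *₀ (numOth (lab d) (lab e) ÷₀ denOth (lab d) (lab e))
    claim-other i d e isMin isMax (i′ , i<i′ , j , conn)
      with Conn⇒Endpoint i (proj₁ isMin) | Conn⇒Endpoint i′ conn
    ... | t , ≡.refl | t′ , ≡.refl
      -- A later connected vertex has a larger index because `p` is increasing, so `t` is not the
      -- last index and its chord does not wrap around.
      with ℕ.≤-trans (s≤s (increasing-reflects-< p-inc {t} {t′} i<i′)) (Fin.toℕ<n t′)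
    ...   | 1+t<r with min-≡x 1+t<r isMin | max-≡x-cyc 1+t<r isMax
    ...     | ≡.refl | ≡.refl =
      *₀-÷₀-unique (just (y′ v)) (just (y v)) num den (den-NonZero {∏ z 0 d′} {den} d′≤n den-eq)
        (*₀-cancel {a = just (y′ v) *₀ den} {just (y v) *₀ num} (∏z-NonZero 0 d′)
          (ratio-off-circle {just (y′ v)} {just (y v)} {num} {den} {∏ z 0 d′}
            {w d′} {w e′}
            (≡.subst (λ T → w d′ *₀ just (y′ v) ≈₀ just (y v) *₀ T)
              (target-≤ 0 z (ℕ.<⇒≤ (x<x-cyc 1+t<r))) (off t))
            (*-paper-sum (s≤s (ℕ.<⇒≤ (x<x-cyc 1+t<r))) (s≤s (≤M (x (cyc t))))) den-eq))
      where
      v = vtx (p t)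
      d′ = lab (x t)
      e′ = lab (x (cyc t))
      num = numOth d′ e′
      den = denOth d′ e′
      d′≤n : d′ ≤ n
      d′≤n = s≤s (≤M (x t))
      den-eq : ∏ z 0 d′ *₀ den ≈₀ w d′
      den-eq = *-paper-sum-shift d′≤n

    circle-claims : CircleClaims cc vtx
    circle-claims = claim-unconnected , claim-last , claim-other

  claims : Theorem6p8Claims
  claims = claim1 , claim2
    , CircleClaim.circle-claims outer out (λ _ _ → ≡.refl) (λ _ _ → ≡.refl) (λ _ _ _ ())
    , CircleClaim.circle-claims inner inn (λ _ _ → ≡.refl) (λ _ _ → ≡.refl) (λ _ _ _ ())

theorem6p8 : ∀ {c ℓ : Level} (F : Semifield c ℓ) (D : SpiderData)
    (y : V D → Semifield.Carrier F) → Formulas.Theorem6p8Claims F D y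
theorem6p8 F record { n = suc (suc N) ; 2≤a = 2≤a ; 2≤n = 2≤n ; 2≤b = 2≤b ; outer = outer ; inner = inner } y =
  Claims.claims F _ _ N 2≤a 2≤n 2≤b outer inner y
theorem6p8 F record { n = suc zero ; 2≤n = s≤s () } y
theorem6p8 F record { n = zero ; 2≤n = () } y
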